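{- Let $\mathscr{A}=(\mathscr{C},\mathscr{O})$ be an algebra inherited from the algebra $\mathfrak{G}$ of finite graphs, and let $\varphi$ be a sentence of the monadic second-order language of graphs. Then for every $n\in\mathbb{N}$, the set $\{\,G\in\mathscr{C}_n : \models_{\Omega(G)}\varphi\,\}$ is $\mathscr{A}$-recognisable.
   Context: Graphs. $\mathbb{N}$ contains $0$. A graph is $G=(V,E,\langle\_\rangle)$ with $V$ a finite nonempty set of vertices, $E$ a finite set of edges disjoint from $V$, and $\langle\_\rangle:E\to V^*$ assigning to every edge $e$ a nonempty finite word of vertices (its end points); $|e|$ denotes the length of $\langle e\rangle$. (So graphs are hypergraphs; parallel edges and repeated end points are allowed.) A graph of type $n\in\mathbb{N}$ is a graph together with a (not necessarily injective) map $t:\{1,\dots,n\}\to V$; the $t(i)$ are its terminals. $\mathfrak{G}_n$ is the set of graphs of type $n$; names of vertices and edges are immaterial, i.e. two typed graphs are identified if there are bijections of vertices and edges preserving the words $\langle e\rangle$ and the map $t$. Monadic second-order language of graphs. Formulas are built with $\neg,\wedge,\forall$ (other connectives and $\exists$ being abbreviations) from individual variables and set variables (unary predicate variables), with atomic formulas $\mathrm{vert}(x)$, $\mathrm{edge}(x)$, $x=y$, $X(x)$ and, for each $m\in\mathbb{N}$, $\mathrm{conn}_m(y,x_1,\dots,x_m)$; quantification is over individual variables and set variables. A sentence is a formula without free variables. In the structure $\Omega(G)$ induced by a graph $G$, individual variables range over $V\cup E$, set variables range over all subsets of $V$ and all subsets of $E$, $\mathrm{vert}$ and $\mathrm{edge}$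 mean membership in $V$ and $E$, $X(x)$ means $x\in X$, and $\mathrm{conn}_m(y,x_1,\dots,x_m)$ holds iff $y\in E$ and $\langle y\rangle=x_1\cdots x_m$. (Terminals are not visible.) $\models_{\Omega(G)}\varphi$ means $\varphi$ is true in $\Omega(G)$. Algebras. A signature $\mathscr{S}=(\mathscr{T},\mathscr{F},\langle\_\rangle)$ consists of a set $\mathscr T$ of sorts, a set $\mathscr F$ of function symbols and a typing $\langle f\rangle=(t_1\cdots t_r,t)\in\mathscr{T}^*\times\mathscr{T}$ for $f\in\mathscr{F}$ ($r$ is the arity, $t$ the output sort). An $\mathscr{S}$-algebra $\mathscr{A}=(\mathscr{C},\mathscr{O})$ consists of disjoint carrier sets $\mathscr{C}_t$ ($t\in\mathscr{T}$) and operations $\mathscr{O}_f:\mathscr{C}_{t_1}\times\dots\times\mathscr{C}_{t_r}\to\mathscr{C}_t$. An $\mathscr{S}$-algebra morphism is a sort-indexed family of maps of carriers commuting with all operations. An algebra is locally finite if each carrier is finite. For $t\in\mathscr T$, a subset $\mathscr{L}\subseteq\mathscr{C}_t$ is $\mathscr{A}$-recognisable if there are a locally finite $\mathscr{S}$-algebra $\mathscr{B}$ with carriers $\mathscr{D}_u$, an $\mathscr{S}$-algebra morphism $h=(h_u)_u:\mathscr{A}\to\mathscr{B}$ and a subset $\mathscr{M}\subseteq\mathscr{D}_t$ with $\mathscr{L}=h_t^{ -1}(\mathscr{M})$. Inherited algebras. A pre-expression over a signature is a finite nonempty rooted ordered tree with vertices labelled by function symbols such that a vertex labelled $f$ has either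 no children or exactly as many children as the arity of $f$, in the latter case with the output sorts of the children's labels equal, in order, to the input sorts of $f$. Its input type is the concatenation, over the leaves in traversal order, of the input types of their labels; its output sort is that of the root label. In an algebra it defines, by evaluating from the leaves upward, an operation of this type. The closure $\overline{\mathscr{A}}$ of $\mathscr{A}$ is $\mathscr{A}$ with, for every sort $t$ and every $c\in\mathscr{C}_t$, an additional nullary function symbol of value $c$. The flattening $\mathrm{Fl}(\mathscr{A})$ is $\mathscr{A}$ with, for every pre-expression over its signature, an additional function symbol of the same type whose operation is evaluation of that pre-expression. A subalgebra has the same set of sorts, a subset of the function symbols (with the same typing), subsets of the carriers, and the restricted operations (the carriers being closed under them). $\mathscr{B}$ is inherited from $\mathscr{A}$ if $\mathscr{B}$ is a subalgebra of $\mathrm{Fl}(\overline{\mathscr{A}})$. The algebra $\mathfrak{G}$. Its sorts are the elements of $\mathbb{N}$, its carriers are the $\mathfrak{G}_n$, and its operations are: (i) for all $n,m$, the disjoint sum $\oplus:\mathfrak{G}_n\times\mathfrak{G}_m\to\mathfrak{G}_{n+m}$ (disjoint union, terminals of the first graph followed by those of the second); (ii) for every map $\sigma:\{1,\dots,n\}\to\{1,\dots,m\}$ the terminal redefinition $\mathfrak{G}_m\to\mathfrak{G}_n$, $(G,t)\mapsto(G,t\circ\sigma)$; (iii) for $a,b\in\{1,\dots,n\}$ the fusion $\mathfrak{G}_n\to\mathfrak{G}_n$ identifying the vertices $t(a)$ and $t(b)$ (all edges kept, words and terminal map transported along the identification; the identity if $t(a)=t(b)$); (iv) the constant $\mathfrak{v}\in\mathfrak{G}_1$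 (one vertex, no edges, the vertex is the terminal) and for $n\ge1$ the constant $\mathfrak{e}_n\in\mathfrak{G}_n$ ($n$ distinct vertices $v_1,\dots,v_n$, one edge $e$ with $\langle e\rangle=v_1\cdots v_n$, $t(i)=v_i$). -}

module Defs where

open import Level using (Level; 0ℓ; _⊔_) renaming (suc to lsuc)
open import Data.Nat.Base using (ℕ; suc; _+_; NonZero)
open import Data.Fin.Base using (Fin; zero; suc; _↑ˡ_; _↑ʳ_; splitAt; punchIn; punchOut)
open import Data.Fin.Properties
  using (_≟_; nonZeroIndex; +↔⊎; splitAt-↑ˡ; splitAt-↑ʳ;
         punchInᵢ≢i; punchIn-punchOut; punchOut-punchIn; punchOut-cong)
open import Data.Fin.Subset as Subset using (Subset)
open import Data.List.Base as List using (List; []; _∷_; _++_)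
open import Data.List.NonEmpty as List⁺ using (List⁺; _∷_; toList)
import Data.List.NonEmpty.Properties as List⁺
open import Data.List.Relation.Unary.All as All using (All; []; _∷_)
open import Data.List.Relation.Unary.All.Properties using (++⁻ˡ; ++⁻ʳ)
open import Data.Vec.Base as Vec using (Vec; []; _∷_; lookup)
open import Data.Product.Base using (Σ; Σ-syntax; ∃; ∃-syntax; _×_; _,_; proj₁; proj₂)
open import Data.Sum.Base using (_⊎_; inj₁; inj₂; [_,_]′)
open import Data.Sum.Function.Propositional using (_⊎-↔_)
open import Data.Empty using (⊥)
open import Function.Base using (_∘_; id)
open import Function.Bundles using (Inverse; _↔_; mk↔ₛ′)
open import Function.Construct.Identity using (↔-id)
open import Function.Construct.Composition using (_↔-∘_)
open import Function.Construct.Symmetry using (↔-sym)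
open import Relation.Binary.Bundles using (Setoid)
open import Relation.Binary.Definitions using (_Respects_)
open import Relation.Binary.PropositionalEquality
  using (_≡_; _≢_; refl; sym; trans; cong; setoid; module ≡-Reasoning)
open import Relation.Nullary using (¬_; yes; no; contradiction)
open import Relation.Unary using (Pred; _≐_)

open Inverse using (to; from; strictlyInverseˡ; strictlyInverseʳ)

record Signature (s f : Level) : Set (lsuc (s ⊔ f)) where
  field
    Sort : Set s
    Fun  : Set f
    dom  : Fun → List Sort
    cod  : Fun → Sort

-- Carriers are setoids because the graph carriers are taken up to isomorphism.

module _ {s c ℓ : Level} {Sort : Set s} (C : Sort → Setoid c ℓ) where

  Tuple : List Sort → Set (s ⊔ c)
  Tuple = All (λ t → Setoid.Carrier (C t))

  data _≈*_ : ∀ {ts} → Tuple ts → Tuple ts → Set (s ⊔ c ⊔ ℓ) where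
    []  : [] ≈* []
    _∷_ : ∀ {t ts} {x y : Setoid.Carrier (C t)} {xs ys : Tuple ts} →
          Setoid._≈_ (C t) x y → xs ≈* ys → (x ∷ xs) ≈* (y ∷ ys)

record Algebra {s f : Level} (S : Signature s f) (c ℓ : Level) : Set (s ⊔ f ⊔ lsuc (c ⊔ ℓ)) where
  open Signature S
  field
    carrier : Sort → Setoid c ℓ

  Carrier : Sort → Set c
  Carrier t = Setoid.Carrier (carrier t)

  _≈_ : ∀ {t} → Carrier t → Carrier t → Set ℓ
  _≈_ {t} = Setoid._≈_ (carrier t)

  field
    op      : ∀ g → Tuple carrier (dom g) → Carrier (cod g)
    op-cong : ∀ g {xs ys} → _≈*_ carrier xs ys → op g xs ≈ op g ys

record Morphism {s f c ℓ c′ ℓ′ : Level} {S : Signature s f}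
                (A : Algebra S c ℓ) (B : Algebra S c′ ℓ′) :
                Set (s ⊔ f ⊔ c ⊔ ℓ ⊔ c′ ⊔ ℓ′) where
  open Signature S
  private
    module A = Algebra A
    module B = Algebra B
  field
    map      : ∀ t → A.Carrier t → B.Carrier t
    map-cong : ∀ t {x y} → x A.≈ y → map t x B.≈ map t y
    map-op   : ∀ g xs → map (cod g) (A.op g xs) B.≈ B.op g (All.map (λ {t} → map t) xs)

LocallyFinite : ∀ {s f c ℓ} {S : Signature s f} → Algebra S c ℓ → Set (s ⊔ c ⊔ ℓ)
LocallyFinite {S = S} A = ∀ t → ∃[ k ] Inverse (carrier t) (setoid (Fin k))
  where
  open Algebra A

-- As the carriers of the recognising algebra are finite, nothing is lost by
-- requiring them to be small.

record Recognisable {s f c ℓ p : Level} {S : Signature s f} (A : Algebra S c ℓ)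
                    (t : Signature.Sort S) (L : Pred (Algebra.Carrier A t) p) :
                    Set (s ⊔ f ⊔ c ⊔ ℓ ⊔ p ⊔ lsuc 0ℓ) where
  field
    B             : Algebra S 0ℓ 0ℓ
    locallyFinite : LocallyFinite B
    h             : Morphism A B
    M             : Pred (Algebra.Carrier B t) 0ℓ
    M-resp        : M Respects Algebra._≈_ B
    preimage      : L ≐ (M ∘ Morphism.map h t)

-- For a nullary symbol g, `leaf g` and `node g []` stand for the same tree;
-- they have the same type and the same value.

module _ {s f : Level} (S : Signature s f) where
  open Signature S

  data PreExpr : Sort → Set (s ⊔ f) where
    leaf : ∀ g → PreExpr (cod g)
    node : ∀ g → All PreExpr (dom g) → PreExpr (cod g)

module _ {s f : Level} {S : Signature s f} where
  open Signature S

  inputs  : ∀ {t} → PreExpr S t → List Sort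
  inputs* : ∀ {ts} → All (PreExpr S) ts → List Sort
  inputs (leaf g)    = dom g
  inputs (node g es) = inputs* es
  inputs* []       = []
  inputs* (e ∷ es) = inputs e ++ inputs* es

  module _ {c ℓ : Level} (A : Algebra S c ℓ) where
    open Algebra A

    eval  : ∀ {t} (e : PreExpr S t) → Tuple carrier (inputs e) → Carrier t
    eval* : ∀ {ts} (es : All (PreExpr S) ts) → Tuple carrier (inputs* es) → Tuple carrier ts
    eval (leaf g)    xs = op g xs
    eval (node g es) xs = op g (eval* es xs)
    eval* []       xs = []
    eval* (e ∷ es) xs = eval e (++⁻ˡ (inputs e) xs) ∷ eval* es (++⁻ʳ (inputs e) xs)

    private
      _≋_ : ∀ {ts} → Tuple carrier ts → Tuple carrier ts → Set (s ⊔ c ⊔ ℓ)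
      _≋_ = _≈*_ carrier

    ++⁻ˡ-cong : ∀ ts {us} {xs ys : Tuple carrier (ts ++ us)} → xs ≋ ys → ++⁻ˡ ts xs ≋ ++⁻ˡ ts ys
    ++⁻ˡ-cong []       _       = []
    ++⁻ˡ-cong (_ ∷ ts) (p ∷ ps) = p ∷ ++⁻ˡ-cong ts ps

    ++⁻ʳ-cong : ∀ ts {us} {xs ys : Tuple carrier (ts ++ us)} → xs ≋ ys → ++⁻ʳ ts xs ≋ ++⁻ʳ ts ys
    ++⁻ʳ-cong []       ps       = ps
    ++⁻ʳ-cong (_ ∷ ts) (_ ∷ ps) = ++⁻ʳ-cong ts ps

    eval-cong  : ∀ {t} (e : PreExpr S t) {xs ys} → xs ≋ ys → eval e xs ≈ eval e ys
    eval*-cong : ∀ {ts} (es : All (PreExpr S) ts) {xs ys} → xs ≋ ys → eval* es xs ≋ eval* es ys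
    eval-cong (leaf g)    ps = op-cong g ps
    eval-cong (node g es) ps = op-cong g (eval*-cong es ps)
    eval*-cong []       _  = []
    eval*-cong (e ∷ es) ps =
      eval-cong e (++⁻ˡ-cong (inputs e) ps) ∷ eval*-cong es (++⁻ʳ-cong (inputs e) ps)

module _ {s f c ℓ : Level} {S : Signature s f} (A : Algebra S c ℓ) where
  open Signature S
  open Algebra A

  closureSignature : Signature s (s ⊔ f ⊔ c)
  closureSignature = record
    { Sort = Sort
    ; Fun  = Fun ⊎ Σ Sort Carrier
    ; dom  = [ dom , (λ _ → []) ]′
    ; cod  = [ cod , proj₁ ]′
    }

  closure : Algebra closureSignature c ℓ
  closure = record
    { carrier = carrier
    ; op      = λ { (inj₁ g) xs → op g xs ; (inj₂ (t , x)) _ → x }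
    ; op-cong = λ { (inj₁ g) ps → op-cong g ps ; (inj₂ (t , x)) _ → Setoid.refl (carrier t) }
    }

  flatteningSignature : Signature s (s ⊔ f)
  flatteningSignature = record
    { Sort = Sort
    ; Fun  = Fun ⊎ Σ Sort (PreExpr S)
    ; dom  = [ dom , inputs ∘ proj₂ ]′
    ; cod  = [ cod , proj₁ ]′
    }

  flattening : Algebra flatteningSignature c ℓ
  flattening = record
    { carrier = carrier
    ; op      = λ { (inj₁ g) → op g ; (inj₂ (_ , e)) → eval A e }
    ; op-cong = λ { (inj₁ g) → op-cong g ; (inj₂ (_ , e)) → eval-cong A e }
    }

record Subalgebra {s f c ℓ : Level} {S : Signature s f} (A : Algebra S c ℓ) (p q : Level) :
                  Set (s ⊔ f ⊔ c ⊔ ℓ ⊔ lsuc (p ⊔ q)) where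
  open Signature S
  open Algebra A
  field
    InFun       : Pred Fun p
    InCarrier   : ∀ t → Pred (Carrier t) q
    InCarrier-≈ : ∀ t → InCarrier t Respects _≈_
    closed      : ∀ g → InFun g → (xs : All (λ t → ∃ (InCarrier t)) (dom g)) →
                  InCarrier (cod g) (op g (All.map proj₁ xs))

  signature : Signature s (f ⊔ p)
  signature = record
    { Sort = Sort
    ; Fun  = ∃ InFun
    ; dom  = dom ∘ proj₁
    ; cod  = cod ∘ proj₁
    }

  subcarrier : Sort → Setoid (c ⊔ q) ℓ
  subcarrier t = record
    { Carrier       = ∃ (InCarrier t)
    ; _≈_           = λ x y → proj₁ x ≈ proj₁ y
    ; isEquivalence = record
      { refl  = Setoid.refl (carrier t)
      ; sym   = Setoid.sym (carrier t)
      ; trans = Setoid.trans (carrier t)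
      }
    }

  map-proj₁-cong : ∀ {ts} {xs ys : Tuple subcarrier ts} → _≈*_ subcarrier xs ys →
                   _≈*_ carrier (All.map proj₁ xs) (All.map proj₁ ys)
  map-proj₁-cong []       = []
  map-proj₁-cong (p ∷ ps) = p ∷ map-proj₁-cong ps

  algebra : Algebra signature (c ⊔ q) ℓ
  algebra = record
    { carrier = subcarrier
    ; op      = λ { (g , g∈) xs → op g (All.map proj₁ xs) , closed g g∈ xs }
    ; op-cong = λ { (g , _) ps → op-cong g (map-proj₁-cong ps) }
    }

InheritedAlgebra : ∀ {s f c ℓ} {S : Signature s f} → Algebra S c ℓ → (p q : Level) →
                   Set (s ⊔ f ⊔ c ⊔ ℓ ⊔ lsuc (p ⊔ q))
InheritedAlgebra A = Subalgebra (flattening (closure A))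

-- Names of vertices and edges are immaterial, so vertices and edges are
-- numbered; disjointness of the two is enforced by the tagged sum in Ω.

record Graph : Set where
  field
    order       : ℕ
    size        : ℕ
    .{{nonEmpty}} : NonZero order
    ends        : Fin size → List⁺ (Fin order)

  Vertex : Set
  Vertex = Fin order

  Edge : Set
  Edge = Fin size

record TypedGraph (n : ℕ) : Set where
  field
    graph    : Graph
    terminal : Fin n → Graph.Vertex graph

  open Graph graph public

record _≅_ {n : ℕ} (G H : TypedGraph n) : Set where
  private
    module G = TypedGraph G
    module H = TypedGraph H
  field
    vertices  : G.Vertex ↔ H.Vertex
    edges     : G.Edge ↔ H.Edge
    ends      : ∀ e → List⁺.map (to vertices) (G.ends e) ≡ H.ends (to edges e)
    terminals : ∀ i → to vertices (G.terminal i) ≡ H.terminal i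

-- The vertex set obtained from Fin n by identifying u and v, with the
-- projection onto it: v, if different from u, is deleted and sent to u.

collapse : ∀ {n} {u v : Fin (suc n)} → u ≢ v → Fin (suc n) → Fin n
collapse {v = v} u≢v w with v ≟ w
... | yes _   = punchOut (u≢v ∘ sym)
... | no  v≢w = punchOut v≢w

identify : ∀ {n} → Fin n → Fin n → Σ[ m ∈ ℕ ] (Fin n → Fin m)
identify {suc n} u v with u ≟ v
... | yes _   = suc n , id
... | no  u≢v = n , collapse u≢v

_⊕_ : ∀ {n m} → TypedGraph n → TypedGraph m → TypedGraph (n + m)
_⊕_ {n} G H = record
  { graph = record
    { order    = G.order + H.order
    ; size     = G.size + H.size
    ; nonEmpty = nonZero-+ G.order
    ; ends     = [ List⁺.map (_↑ˡ H.order) ∘ G.ends , List⁺.map (G.order ↑ʳ_) ∘ H.ends ]′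
                 ∘ splitAt G.size
    }
  ; terminal = [ (_↑ˡ H.order) ∘ G.terminal , (G.order ↑ʳ_) ∘ H.terminal ]′ ∘ splitAt n
  }
  where
  module G = TypedGraph G
  module H = TypedGraph H
  nonZero-+ : ∀ k {l} → .{{NonZero k}} → NonZero (k + l)
  nonZero-+ (suc k) = _

redefine : ∀ {n m} → (Fin n → Fin m) → TypedGraph m → TypedGraph n
redefine σ G = record { graph = G.graph ; terminal = G.terminal ∘ σ }
  where module G = TypedGraph G

fuse : ∀ {n} → Fin n → Fin n → TypedGraph n → TypedGraph n
fuse a b G = record
  { graph = record
    { order    = proj₁ quotient
    ; size     = G.size
    ; nonEmpty = nonZeroIndex (proj₂ quotient (G.terminal a))
    ; ends     = List⁺.map (proj₂ quotient) ∘ G.ends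
    }
  ; terminal = proj₂ quotient ∘ G.terminal
  }
  where
  module G = TypedGraph G
  quotient : Σ[ m ∈ ℕ ] (G.Vertex → Fin m)
  quotient = identify (G.terminal a) (G.terminal b)

𝔳 : TypedGraph 1
𝔳 = record
  { graph    = record { order = 1 ; size = 0 ; ends = λ () }
  ; terminal = id
  }

-- 𝔢 k has k + 1 terminals.

𝔢 : ∀ k → TypedGraph (suc k)
𝔢 k = record
  { graph    = record { order = suc k ; size = 1 ; ends = λ _ → zero ∷ List.tabulate suc }
  ; terminal = id
  }

≅-refl : ∀ {n} {G : TypedGraph n} → G ≅ G
≅-refl {G = G} = record
  { vertices  = ↔-id _
  ; edges     = ↔-id _
  ; ends      = λ e → List⁺.map-id _
  ; terminals = λ _ → refl
  }

≅-sym : ∀ {n} {G H : TypedGraph n} → G ≅ H → H ≅ G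
≅-sym {G = G} {H} i = record
  { vertices  = ↔-sym vertices
  ; edges     = ↔-sym edges
  ; ends      = λ e → begin
      List⁺.map (from vertices) (H.ends e)
        ≡⟨ cong (List⁺.map (from vertices) ∘ H.ends) (strictlyInverseˡ edges e) ⟨
      List⁺.map (from vertices) (H.ends (to edges (from edges e)))
        ≡⟨ cong (List⁺.map (from vertices)) (ends (from edges e)) ⟨
      List⁺.map (from vertices) (List⁺.map (to vertices) (G.ends (from edges e)))
        ≡⟨ List⁺.map-∘ _ ⟨
      List⁺.map (from vertices ∘ to vertices) (G.ends (from edges e))
        ≡⟨ List⁺.map-cong (strictlyInverseʳ vertices) _ ⟩
      List⁺.map id (G.ends (from edges e))
        ≡⟨ List⁺.map-id _ ⟩
      G.ends (from edges e) ∎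
  ; terminals = λ j → trans (cong (from vertices) (sym (terminals j))) (strictlyInverseʳ vertices _)
  }
  where
  open _≅_ i
  open ≡-Reasoning
  module G = TypedGraph G
  module H = TypedGraph H

≅-trans : ∀ {n} {G H K : TypedGraph n} → G ≅ H → H ≅ K → G ≅ K
≅-trans {G = G} i j = record
  { vertices  = J.vertices ↔-∘ I.vertices
  ; edges     = J.edges ↔-∘ I.edges
  ; ends      = λ e → trans (List⁺.map-∘ _)
                        (trans (cong (List⁺.map (to J.vertices)) (I.ends e)) (J.ends (to I.edges e)))
  ; terminals = λ k → trans (cong (to J.vertices) (I.terminals k)) (J.terminals k)
  }
  where
  module I = _≅_ i
  module J = _≅_ j

𝔊-setoid : ℕ → Setoid 0ℓ 0ℓ
𝔊-setoid n = record
  { Carrier       = TypedGraph n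
  ; _≈_           = _≅_
  ; isEquivalence = record { refl = ≅-refl ; sym = ≅-sym ; trans = ≅-trans }
  }

+-↔ : ∀ {a a′ b b′} → Fin a ↔ Fin a′ → Fin b ↔ Fin b′ → Fin (a + b) ↔ Fin (a′ + b′)
+-↔ f g = ↔-sym +↔⊎ ↔-∘ ((f ⊎-↔ g) ↔-∘ +↔⊎)

+-↔-↑ˡ : ∀ {a a′ b b′} (f : Fin a ↔ Fin a′) (g : Fin b ↔ Fin b′) x →
         to (+-↔ f g) (x ↑ˡ b) ≡ to f x ↑ˡ b′
+-↔-↑ˡ {a} {b = b} f g x rewrite splitAt-↑ˡ a x b = refl

+-↔-↑ʳ : ∀ {a a′ b b′} (f : Fin a ↔ Fin a′) (g : Fin b ↔ Fin b′) x →
         to (+-↔ f g) (a ↑ʳ x) ≡ a′ ↑ʳ to g x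
+-↔-↑ʳ {a} {b = b} f g x rewrite splitAt-↑ʳ a b x = refl

⊕-cong : ∀ {n m} {G G′ : TypedGraph n} {H H′ : TypedGraph m} →
         G ≅ G′ → H ≅ H′ → (G ⊕ H) ≅ (G′ ⊕ H′)
⊕-cong {n} {m} {G} {G′} {H} {H′} i j = record
  { vertices  = V
  ; edges     = E
  ; ends      = ends
  ; terminals = terminals
  }
  where
  module I = _≅_ i
  module J = _≅_ j
  module G = TypedGraph G
  module G′ = TypedGraph G′
  module H = TypedGraph H
  module H′ = TypedGraph H′
  V : Fin (G.order + H.order) ↔ Fin (G′.order + H′.order)
  V = +-↔ I.vertices J.vertices
  E : Fin (G.size + H.size) ↔ Fin (G′.size + H′.size)
  E = +-↔ I.edges J.edges
  swapˡ : ∀ w → List⁺.map (to V) (List⁺.map (_↑ˡ H.order) w) ≡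
                List⁺.map (_↑ˡ H′.order) (List⁺.map (to I.vertices) w)
  swapˡ w = trans (sym (List⁺.map-∘ w)) (trans (List⁺.map-cong (+-↔-↑ˡ I.vertices J.vertices) w) (List⁺.map-∘ w))
  swapʳ : ∀ w → List⁺.map (to V) (List⁺.map (G.order ↑ʳ_) w) ≡
                List⁺.map (G′.order ↑ʳ_) (List⁺.map (to J.vertices) w)
  swapʳ w = trans (sym (List⁺.map-∘ w)) (trans (List⁺.map-cong (+-↔-↑ʳ I.vertices J.vertices) w) (List⁺.map-∘ w))
  ends : ∀ e → List⁺.map (to V) (TypedGraph.ends (G ⊕ H) e) ≡ TypedGraph.ends (G′ ⊕ H′) (to E e)
  ends e with splitAt G.size e
  ... | inj₁ x rewrite splitAt-↑ˡ G′.size (to I.edges x) H′.size =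
          trans (swapˡ (G.ends x)) (cong (List⁺.map (_↑ˡ H′.order)) (I.ends x))
  ... | inj₂ y rewrite splitAt-↑ʳ G′.size H′.size (to J.edges y) =
          trans (swapʳ (H.ends y)) (cong (List⁺.map (G′.order ↑ʳ_)) (J.ends y))
  terminals : ∀ k → to V (TypedGraph.terminal (G ⊕ H) k) ≡ TypedGraph.terminal (G′ ⊕ H′) k
  terminals k with splitAt n k
  ... | inj₁ x = trans (+-↔-↑ˡ I.vertices J.vertices _) (cong (_↑ˡ H′.order) (I.terminals x))
  ... | inj₂ y = trans (+-↔-↑ʳ I.vertices J.vertices _) (cong (G′.order ↑ʳ_) (J.terminals y))

redefine-cong : ∀ {n m} (σ : Fin n → Fin m) {G H : TypedGraph m} →
                G ≅ H → redefine σ G ≅ redefine σ H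
redefine-cong σ i = record
  { vertices  = vertices
  ; edges     = edges
  ; ends      = ends
  ; terminals = terminals ∘ σ
  }
  where open _≅_ i

record IsIdentification {n m : ℕ} (u v : Fin n) (q : Fin n → Fin m) : Set where
  field
    glues     : q u ≡ q v
    section   : Fin m → Fin n
    q∘section : ∀ y → q (section y) ≡ y
    section∘q : ∀ w → section (q w) ≡ w ⊎ (section (q w) ≡ u × w ≡ v)

collapse-isIdentification : ∀ {n} {u v : Fin (suc n)} (u≢v : u ≢ v) →
                            IsIdentification u v (collapse u≢v)
collapse-isIdentification {n} {u} {v} u≢v = record
  { glues     = glues
  ; section   = punchIn v
  ; q∘section = q∘section
  ; section∘q = section∘q
  }
  where
  glues : collapse u≢v u ≡ collapse u≢v v
  glues with v ≟ u | v ≟ v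
  ... | yes v≡u | _       = contradiction (sym v≡u) u≢v
  ... | no  _   | yes _   = punchOut-cong v refl
  ... | no  _   | no  v≢v = contradiction refl v≢v
  q∘section : ∀ y → collapse u≢v (punchIn v y) ≡ y
  q∘section y with v ≟ punchIn v y
  ... | yes v≡ = contradiction (sym v≡) (punchInᵢ≢i v y)
  ... | no  _  = trans (punchOut-cong v refl) (punchOut-punchIn v)
  section∘q : ∀ w → punchIn v (collapse u≢v w) ≡ w ⊎ (punchIn v (collapse u≢v w) ≡ u × w ≡ v)
  section∘q w with v ≟ w
  ... | yes v≡w = inj₂ (punchIn-punchOut (u≢v ∘ sym) , sym v≡w)
  ... | no  v≢w = inj₁ (punchIn-punchOut v≢w)

identify-isIdentification : ∀ {n} (u v : Fin n) → IsIdentification u v (proj₂ (identify u v))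
identify-isIdentification {suc n} u v with u ≟ v
... | yes u≡v = record
  { glues     = u≡v
  ; section   = id
  ; q∘section = λ _ → refl
  ; section∘q = λ _ → inj₁ refl
  }
... | no u≢v = collapse-isIdentification u≢v

module _ {n m n′ m′ : ℕ} {u v : Fin n} {u′ v′ : Fin n′}
         {q : Fin n → Fin m} {q′ : Fin n′ → Fin m′}
         (Q : IsIdentification u v q) (Q′ : IsIdentification u′ v′ q′)
         (f : Fin n → Fin n′) (fu : f u ≡ u′) (fv : f v ≡ v′) where
  private
    module Q = IsIdentification Q
    module Q′ = IsIdentification Q′

  descend : Fin m → Fin m′
  descend = q′ ∘ f ∘ Q.section

  descend-q : ∀ w → descend (q w) ≡ q′ (f w)
  descend-q w with Q.section∘q w
  ... | inj₁ sqw≡w         = cong (q′ ∘ f) sqw≡w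
  ... | inj₂ (sqw≡u , w≡v) = begin
    q′ (f (Q.section (q w))) ≡⟨ cong (q′ ∘ f) sqw≡u ⟩
    q′ (f u)                 ≡⟨ cong q′ fu ⟩
    q′ u′                    ≡⟨ Q′.glues ⟩
    q′ v′                    ≡⟨ cong q′ fv ⟨
    q′ (f v)                 ≡⟨ cong (q′ ∘ f) w≡v ⟨
    q′ (f w)                 ∎
    where open ≡-Reasoning

fuse-cong : ∀ {n} (a b : Fin n) {G H : TypedGraph n} → G ≅ H → fuse a b G ≅ fuse a b H
fuse-cong a b {G} {H} i = record
  { vertices  = mk↔ₛ′ f⁺ f⁻
      (λ y → trans (forth (from vertices (H⁺.section y)))
               (trans (cong qH (strictlyInverseˡ vertices _)) (H⁺.q∘section y)))
      (λ x → trans (back (to vertices (G⁺.section x)))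
               (trans (cong qG (strictlyInverseʳ vertices _)) (G⁺.q∘section x)))
  ; edges     = edges
  ; ends      = λ e → begin
      List⁺.map f⁺ (List⁺.map qG (G.ends e))            ≡⟨ List⁺.map-∘ _ ⟨
      List⁺.map (f⁺ ∘ qG) (G.ends e)                    ≡⟨ List⁺.map-cong forth _ ⟩
      List⁺.map (qH ∘ to vertices) (G.ends e)           ≡⟨ List⁺.map-∘ _ ⟩
      List⁺.map qH (List⁺.map (to vertices) (G.ends e)) ≡⟨ cong (List⁺.map qH) (ends e) ⟩
      List⁺.map qH (H.ends (to edges e))                ∎
  ; terminals = λ k → trans (forth (G.terminal k)) (cong qH (terminals k))
  }
  where
  open _≅_ i
  open ≡-Reasoning
  module G = TypedGraph G
  module H = TypedGraph H
  qG : Fin G.order → Fin (proj₁ (identify (G.terminal a) (G.terminal b)))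
  qG = proj₂ (identify (G.terminal a) (G.terminal b))
  qH : Fin H.order → Fin (proj₁ (identify (H.terminal a) (H.terminal b)))
  qH = proj₂ (identify (H.terminal a) (H.terminal b))
  QG : IsIdentification (G.terminal a) (G.terminal b) qG
  QG = identify-isIdentification _ _
  QH : IsIdentification (H.terminal a) (H.terminal b) qH
  QH = identify-isIdentification _ _
  module G⁺ = IsIdentification QG
  module H⁺ = IsIdentification QH
  module I⁻ = _≅_ (≅-sym i)
  f⁺ : Fin (proj₁ (identify (G.terminal a) (G.terminal b))) →
       Fin (proj₁ (identify (H.terminal a) (H.terminal b)))
  f⁺ = descend QG QH (to vertices) (terminals a) (terminals b)
  f⁻ : Fin (proj₁ (identify (H.terminal a) (H.terminal b))) →
       Fin (proj₁ (identify (G.terminal a) (G.terminal b)))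
  f⁻ = descend QH QG (from vertices) (I⁻.terminals a) (I⁻.terminals b)
  forth : ∀ w → f⁺ (qG w) ≡ qH (to vertices w)
  forth = descend-q QG QH (to vertices) (terminals a) (terminals b)
  back : ∀ w → f⁻ (qH w) ≡ qG (from vertices w)
  back = descend-q QH QG (from vertices) (I⁻.terminals a) (I⁻.terminals b)

data GraphFun : Set where
  sum    : (n m : ℕ) → GraphFun
  redef  : ∀ {n m} → (Fin n → Fin m) → GraphFun
  fusion : ∀ {n} → Fin n → Fin n → GraphFun
  vertex : GraphFun
  edge   : ℕ → GraphFun

graphSignature : Signature 0ℓ 0ℓ
graphSignature = record { Sort = ℕ ; Fun = GraphFun ; dom = dom ; cod = cod }
  where
  dom : GraphFun → List ℕ
  dom (sum n m)        = n ∷ m ∷ []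
  dom (redef {n} {m} _) = m ∷ []
  dom (fusion {n} _ _) = n ∷ []
  dom vertex           = []
  dom (edge _)         = []
  cod : GraphFun → ℕ
  cod (sum n m)        = n + m
  cod (redef {n} {m} _) = n
  cod (fusion {n} _ _) = n
  cod vertex           = 1
  cod (edge k)         = suc k

𝔊 : Algebra graphSignature 0ℓ 0ℓ
𝔊 = record { carrier = 𝔊-setoid ; op = op ; op-cong = op-cong }
  where
  open Signature graphSignature
  op : ∀ g → Tuple 𝔊-setoid (dom g) → TypedGraph (cod g)
  op (sum n m)    (G ∷ H ∷ []) = G ⊕ H
  op (redef σ)    (G ∷ [])     = redefine σ G
  op (fusion a b) (G ∷ [])     = fuse a b G
  op vertex       []           = 𝔳
  op (edge k)     []           = 𝔢 k
  op-cong : ∀ g {xs ys} → _≈*_ 𝔊-setoid xs ys → op g xs ≅ op g ys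
  op-cong (sum n m)    (p ∷ q ∷ []) = ⊕-cong p q
  op-cong (redef σ)    (p ∷ [])     = redefine-cong σ p
  op-cong (fusion a b) (p ∷ [])     = fuse-cong a b p
  op-cong vertex       []           = ≅-refl
  op-cong (edge k)     []           = ≅-refl

-- `Formula i s` has i free individual variables and s free set variables,
-- as de Bruijn indices.

infix  6 _≐′_ _∈′_
infix  5 ¬′_
infixr 4 _∧′_
infix  3 ∀₁_ ∀₂_

data Formula (i s : ℕ) : Set where
  vert edge : Fin i → Formula i s
  _≐′_      : Fin i → Fin i → Formula i s
  _∈′_      : Fin i → Fin s → Formula i s
  conn      : ∀ m → Fin i → Vec (Fin i) m → Formula i s
  ¬′_       : Formula i s → Formula i s
  _∧′_      : Formula i s → Formula i s → Formula i s
  ∀₁_       : Formula (suc i) s → Formula i s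
  ∀₂_       : Formula i (suc s) → Formula i s

Sentence : Set
Sentence = Formula 0 0

record Structure : Set₁ where
  field
    Individual : Set
    SetValue   : Set
    Vert Edge  : Pred Individual 0ℓ
    _∈_        : Individual → SetValue → Set
    Conn       : ∀ m → Individual → Vec Individual m → Set

module _ (𝒮 : Structure) where
  open Structure 𝒮

  Holds : ∀ {i s} → Formula i s → Vec Individual i → Vec SetValue s → Set
  Holds (vert x)      ρ θ = Vert (lookup ρ x)
  Holds (edge x)      ρ θ = Edge (lookup ρ x)
  Holds (x ≐′ y)      ρ θ = lookup ρ x ≡ lookup ρ y
  Holds (x ∈′ X)      ρ θ = lookup ρ x ∈ lookup θ X
  Holds (conn m y xs) ρ θ = Conn m (lookup ρ y) (Vec.map (lookup ρ) xs)
  Holds (¬′ φ)        ρ θ = ¬ Holds φ ρ θ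
  Holds (φ ∧′ ψ)      ρ θ = Holds φ ρ θ × Holds ψ ρ θ
  Holds (∀₁ φ)        ρ θ = ∀ x → Holds φ (x ∷ ρ) θ
  Holds (∀₂ φ)        ρ θ = ∀ X → Holds φ ρ (X ∷ θ)

-- A set value is a subset of the vertices or a subset of the edges, never a
-- mixture of both.

Ω : Graph → Structure
Ω G = record
  { Individual = Vertex ⊎ Edge
  ; SetValue   = Subset order ⊎ Subset size
  ; Vert       = λ x → ∃[ v ] x ≡ inj₁ v
  ; Edge       = λ x → ∃[ e ] x ≡ inj₂ e
  ; _∈_        = λ { (inj₁ v) (inj₁ X) → v Subset.∈ X
                   ; (inj₂ e) (inj₂ X) → e Subset.∈ X
                   ; _        _        → ⊥
                   }
  ; Conn       = λ m y xs → ∃[ e ] (y ≡ inj₂ e × List.map inj₁ (toList (ends e)) ≡ Vec.toList xs)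
  }
  where open Graph G

infix 4 ⊨[_]_

⊨[_]_ : Structure → Sentence → Set
⊨[ 𝒮 ] φ = Holds 𝒮 φ [] []

{-# OPTIONS --safe #-}

-- Every individual variable is replaced by a set variable restricted to
-- singletons of vertices or of edges, so that a formula speaks about graphs
-- labelled by sets of known kind.  Sets are carried along the operations by
-- disjoint unions (for ⊕) and images (for fusion).  This makes the operations
-- on labelled graphs total, and every labelling of a result comes from
-- labellings of the arguments; hence the set of states reached by all choices
-- of the innermost label is again compositional, and a quantifier amounts to a
-- powerset construction.  Being a singleton is definable from "two sets meet",
-- equality and membership become meeting of singletons with sets, and conn is
-- expressed by the sets of edges of given length and of j-th end points, which
-- commute with unions and images.  So "two sets meet" is the only atomic
-- predicate for which a finite congruence has to be found.

module Submission where

open import Defs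
open import Level using (Level; 0ℓ)
open import Data.Bool.Base using (Bool; true)
open import Data.Empty using (⊥)
open import Data.Fin.Base using (Fin; zero; suc; toℕ; splitAt; _↑ˡ_; _↑ʳ_)
open import Data.Fin.Properties
  using (_≟_; any?; +↔⊎; *↔×; 2↔Bool; 1↔⊤; splitAt-↑ˡ; splitAt-↑ʳ; join-splitAt;
         ↑ˡ-injective; ↑ʳ-injective)
open import Data.Fin.Subset using (Subset; _∈_; ⁅_⁆)
open import Data.Fin.Subset.Properties
  using (_∈?_; ⊆-antisym; anySubset?; x∈⁅x⁆; x∈⁅y⁆⇒x≡y; x∈⁅y⁆⇔x≡y)
open import Data.List.Base as List using (List; []; _∷_; length)
open import Data.List.Membership.Propositional using () renaming (_∈_ to _∈ˡ_)
open import Data.List.NonEmpty as List⁺ using (List⁺; _∷_; toList)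
import Data.List.NonEmpty.Properties as List⁺
open import Data.List.Properties using (∷-injectiveˡ; ∷-injectiveʳ)
open import Data.List.Relation.Unary.All as All using (All; []; _∷_)
open import Data.List.Relation.Unary.All.Properties using (++⁻ˡ; ++⁻ʳ; map-∘)
open import Data.List.Relation.Unary.Any using (here; there)
open import Data.Nat.Base using (ℕ; zero; suc; _+_; _*_)
import Data.Nat.Properties as ℕ
open import Data.Product.Base using (∃; ∃-syntax; _×_; _,_; proj₁; proj₂)
open import Data.Product.Function.NonDependent.Propositional using (_×-↔_; _×-⇔_)
open import Data.Sum.Base as Sum using (_⊎_; inj₁; inj₂; [_,_]′)
open import Data.Sum.Function.Propositional using (_⊎-↔_; _⊎-⇔_)
open import Data.Sum.Properties using (inj₁-injective; inj₂-injective)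
open import Data.Unit.Base using (⊤; tt)
open import Data.Vec.Base as Vec using (Vec; []; _∷_; lookup)
open import Data.Vec.Properties
  using ([]=⇒lookup; lookup⇒[]=; lookup∘tabulate; tabulate-cong; lookup-map)
open import Function.Base using (_∘_; id)
open import Function.Bundles using (Inverse; Injection; Equivalence; _↔_; _⇔_; mk⇔; mk↔ₛ′)
open import Function.Construct.Composition using (_↔-∘_; _⇔-∘_)
open import Function.Construct.Identity using (↔-id; ⇔-id)
open import Function.Construct.Symmetry using (↔-sym; ⇔-sym)
open import Function.Properties.Inverse using (↔⇒↣)
open import Relation.Binary.Bundles using (Setoid)
open import Relation.Binary.PropositionalEquality
  using (_≡_; _≢_; refl; sym; trans; cong; cong₂; subst; subst₂; setoid)
open import Relation.Nullary using (Dec; yes; no; does; contradiction)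
open import Relation.Nullary.Decidable
  using (dec-true; does-⇔; _×-dec_; _⊎-dec_; map′; via-injection)
open import Relation.Unary using (Pred; Decidable)

open Inverse using (to; from; strictlyInverseˡ; strictlyInverseʳ)
open Equivalence using () renaming (to to ⇒; from to ⇐)
open TypedGraph using (graph; terminal)

-- Finite types and decidable subsets

record Finite (A : Set) : Set where
  constructor finite
  field
    {card} : ℕ
    enum   : A ↔ Fin card

open Finite

Finite-Bool : Finite Bool
Finite-Bool = finite (↔-sym 2↔Bool)

Finite-× : ∀ {A B} → Finite A → Finite B → Finite (A × B)
Finite-× (finite f) (finite g) = finite (↔-sym *↔× ↔-∘ (f ×-↔ g))

Finite-Subset : ∀ n → Finite (Subset n)
Finite-Subset zero    = finite {card = 1}
    (mk↔ₛ′ (λ _ → zero) (λ _ → []) (λ { zero → refl }) (λ { [] → refl }))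
Finite-Subset (suc n) = finite (enum (Finite-× Finite-Bool (Finite-Subset n)) ↔-∘ uncons)
  where
  uncons : Subset (suc n) ↔ (Bool × Subset n)
  uncons = mk↔ₛ′ (λ { (x ∷ xs) → x , xs }) (λ { (x , xs) → x ∷ xs }) (λ _ → refl) (λ { (_ ∷ _) → refl })

-- Abstract, so that unification can recover P? and P from ⟪ P? ⟫.

abstract

  ⟪_⟫ : ∀ {n} {P : Pred (Fin n) 0ℓ} → Decidable P → Subset n
  ⟪ P? ⟫ = Vec.tabulate (does ∘ P?)

  ∈-⟪⟫ : ∀ {n} {P : Pred (Fin n) 0ℓ} (P? : Decidable P) {i} → i ∈ ⟪ P? ⟫ ⇔ P i
  ∈-⟪⟫ {P = P} P? {i} = mk⇔
    (λ i∈ → holds (P? i) (trans (sym (lookup∘tabulate _ i)) ([]=⇒lookup i∈)))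
    (λ p → lookup⇒[]= i _ (trans (lookup∘tabulate _ i) (dec-true (P? i) p)))
    where
    holds : ∀ {A : Set} (a? : Dec A) → does a? ≡ true → A
    holds (yes a) _ = a

  ⟪⟫-cong : ∀ {n} {P Q : Pred (Fin n) 0ℓ} (P? : Decidable P) (Q? : Decidable Q) →
            (∀ i → P i ⇔ Q i) → ⟪ P? ⟫ ≡ ⟪ Q? ⟫
  ⟪⟫-cong P? Q? P⇔Q = tabulate-cong (λ i → does-⇔ (P⇔Q i) (P? i) (Q? i))

⊆⊇⇒≡ : ∀ {n} {X Y : Subset n} → (∀ x → x ∈ X ⇔ x ∈ Y) → X ≡ Y
⊆⊇⇒≡ X⇔Y = ⊆-antisym (⇒ (X⇔Y _)) (⇐ (X⇔Y _))

abstract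

  image : ∀ {m n} → (Fin m → Fin n) → Subset m → Subset n
  image f X = ⟪ (λ y → any? (λ x → (x ∈? X) ×-dec (f x ≟ y))) ⟫

  ∈-image : ∀ {m n} (f : Fin m → Fin n) (X : Subset m) {y} → y ∈ image f X ⇔ (∃[ x ] x ∈ X × f x ≡ y)
  ∈-image f X = ∈-⟪⟫ (λ y → any? (λ x → (x ∈? X) ×-dec (f x ≟ y)))

-- The preimage of `Y` under `f` is a witness; the section `g` ensures that all of `Y` is reached.
-- Hence every label of a fused or isomorphic graph is pushed forward from a label of the original.
image-surjective : ∀ {m n} (f : Fin m → Fin n) (g : Fin n → Fin m) → (∀ y → f (g y) ≡ y) →
                   ∀ Y → ∃[ X ] image f X ≡ Y
image-surjective f g f∘g Y = X , ⊆⊇⇒≡ (λ y → mk⇔ (fwd y ∘ ⇒ (∈-image f X)) (bwd y))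
  where
  X = ⟪ (λ x → f x ∈? Y) ⟫
  fwd : ∀ y → (∃[ x ] x ∈ X × f x ≡ y) → y ∈ Y
  fwd y (x , x∈X , refl) = ⇒ (∈-⟪⟫ _) x∈X
  bwd : ∀ y → y ∈ Y → y ∈ image f X
  bwd y y∈Y = ⇐ (∈-image f X) (g y , ⇐ (∈-⟪⟫ _) (subst (_∈ Y) (sym (f∘g y)) y∈Y) , f∘g y)

Meet : ∀ {n} → Subset n → Subset n → Set
Meet X Y = ∃[ x ] x ∈ X × x ∈ Y

meet? : ∀ {n} (X Y : Subset n) → Dec (Meet X Y)
meet? X Y = any? (λ x → (x ∈? X) ×-dec (x ∈? Y))

-- Powersets of finite types

module _ {A : Set} (F : Finite A) where

  -- Subsets are coded as Boolean vectors along the enumeration, so that subsets with the same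
  -- members are propositionally equal and the powerset is again finite.
  Powerset : Set
  Powerset = Subset (card F)

  comprehension : {P : Pred A 0ℓ} → Decidable P → Powerset
  comprehension P? = ⟪ P? ∘ from (enum F) ⟫

  member : A → Powerset → Set
  member a S = to (enum F) a ∈ S

  member? : ∀ a S → Dec (member a S)
  member? a S = to (enum F) a ∈? S

  member-comprehension : {P : Pred A 0ℓ} (P? : Decidable P) {a : A} →
                         member a (comprehension P?) ⇔ P a
  member-comprehension {P} P? {a} = mk⇔
    (subst P (strictlyInverseʳ (enum F) a) ∘ ⇒ (∈-⟪⟫ (P? ∘ from (enum F))))
    (⇐ (∈-⟪⟫ (P? ∘ from (enum F))) ∘ subst P (sym (strictlyInverseʳ (enum F) a)))

  comprehension-cong : {P Q : Pred A 0ℓ} (P? : Decidable P) (Q? : Decidable Q) →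
                       (∀ a → P a ⇔ Q a) → comprehension P? ≡ comprehension Q?
  comprehension-cong P? Q? P⇔Q = ⟪⟫-cong _ _ (P⇔Q ∘ from (enum F))

  eq? : (a b : A) → Dec (a ≡ b)
  eq? = via-injection (↔⇒↣ (enum F)) _≟_

  search : {P : Pred A 0ℓ} → Decidable P → Dec (∃ P)
  search {P} P? = map′ (λ { (i , p) → from (enum F) i , p })
                       (λ { (a , p) → to (enum F) a , subst P (sym (strictlyInverseʳ (enum F) a)) p })
                       (any? (P? ∘ from (enum F)))

-- Labelled graphs

data Kind : Set where
  V E : Kind

Elt : Kind → Graph → Set
count : Kind → Graph → ℕ
count V = Graph.order
count E = Graph.size
Elt k G = Fin (count k G)

infixr 6 _⊞_

-- The underlying graph of `⊕` does not depend on the terminals, so `graph (G ⊕ H)` and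
-- `graph G ⊞ graph H` agree by definition, and environments over one serve for the other.
_⊞_ : Graph → Graph → Graph
G ⊞ H = TypedGraph.graph (untyped G ⊕ untyped H)
  where
  untyped : Graph → TypedGraph 0
  untyped K = record { graph = K ; terminal = λ () }

↑ˡ≢↑ʳ : ∀ {m n} (x : Fin m) (y : Fin n) → x ↑ˡ n ≢ m ↑ʳ y
↑ˡ≢↑ʳ {m} {n} x y e with () ← trans (sym (splitAt-↑ˡ m x n)) (trans (cong (splitAt m) e) (splitAt-↑ʳ m n y))

-- Disjoint unions of sets of vertices or edges

module Union (G H : Graph) where
  private
    module G = Graph G
    module H = Graph H

  inl : ∀ k → Elt k G → Elt k (G ⊞ H)
  inl V = _↑ˡ H.order
  inl E = _↑ˡ H.size

  inr : ∀ k → Elt k H → Elt k (G ⊞ H)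
  inr V = G.order ↑ʳ_
  inr E = G.size ↑ʳ_

  ends-inl : ∀ e → List⁺.map (inl V) (G.ends e) ≡ Graph.ends (G ⊞ H) (inl E e)
  ends-inl e rewrite splitAt-↑ˡ G.size e H.size = refl

  ends-inr : ∀ e → List⁺.map (inr V) (H.ends e) ≡ Graph.ends (G ⊞ H) (inr E e)
  ends-inr e rewrite splitAt-↑ʳ G.size H.size e = refl

  inl-injective : ∀ k {x y} → inl k x ≡ inl k y → x ≡ y
  inl-injective V = ↑ˡ-injective _ _ _
  inl-injective E = ↑ˡ-injective _ _ _

  inr-injective : ∀ k {x y} → inr k x ≡ inr k y → x ≡ y
  inr-injective V = ↑ʳ-injective _ _ _
  inr-injective E = ↑ʳ-injective _ _ _

  inl≢inr : ∀ k {x y} → inl k x ≢ inr k y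
  inl≢inr V = ↑ˡ≢↑ʳ _ _
  inl≢inr E = ↑ˡ≢↑ʳ _ _

  data Side (k : Kind) : Elt k (G ⊞ H) → Set where
    left  : ∀ x → Side k (inl k x)
    right : ∀ y → Side k (inr k y)

  side : ∀ k z → Side k z
  side V z with splitAt G.order z | join-splitAt G.order H.order z
  ... | inj₁ x | refl = left x
  ... | inj₂ y | refl = right y
  side E z with splitAt G.size z | join-splitAt G.size H.size z
  ... | inj₁ x | refl = left x
  ... | inj₂ y | refl = right y

  module _ (k : Kind) where

    private
      InUnion : Subset (count k G) → Subset (count k H) → Elt k (G ⊞ H) → Set
      InUnion X Y z = (∃[ x ] x ∈ X × inl k x ≡ z) ⊎ (∃[ y ] y ∈ Y × inr k y ≡ z)

      inUnion? : ∀ X Y z → Dec (InUnion X Y z)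
      inUnion? X Y z = any? (λ x → (x ∈? X) ×-dec (inl k x ≟ z))
                       ⊎-dec any? (λ y → (y ∈? Y) ×-dec (inr k y ≟ z))

    abstract

      union : Subset (count k G) → Subset (count k H) → Subset (count k (G ⊞ H))
      union X Y = ⟪ inUnion? X Y ⟫

      inl∈union : ∀ X Y {x} → inl k x ∈ union X Y ⇔ x ∈ X
      inl∈union X Y = mk⇔ (fwd ∘ ⇒ (∈-⟪⟫ (inUnion? X Y)))
                          (λ x∈ → ⇐ (∈-⟪⟫ (inUnion? X Y)) (inj₁ (_ , x∈ , refl)))
        where
        fwd : ∀ {x} → InUnion X Y (inl k x) → x ∈ X
        fwd (inj₁ (x , x∈ , e)) = subst (_∈ X) (inl-injective k e) x∈
        fwd (inj₂ (y , _ , e))  = contradiction (sym e) (inl≢inr k)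

      inr∈union : ∀ X Y {y} → inr k y ∈ union X Y ⇔ y ∈ Y
      inr∈union X Y = mk⇔ (fwd ∘ ⇒ (∈-⟪⟫ (inUnion? X Y)))
                          (λ y∈ → ⇐ (∈-⟪⟫ (inUnion? X Y)) (inj₂ (_ , y∈ , refl)))
        where
        fwd : ∀ {y} → InUnion X Y (inr k y) → y ∈ Y
        fwd (inj₁ (x , _ , e))  = contradiction e (inl≢inr k)
        fwd (inj₂ (y , y∈ , e)) = subst (_∈ Y) (inr-injective k e) y∈

    union-unique : ∀ X Y {Z} → (∀ x → inl k x ∈ Z ⇔ x ∈ X) → (∀ y → inr k y ∈ Z ⇔ y ∈ Y) → Z ≡ union X Y
    union-unique X Y {Z} l r = ⊆⊇⇒≡ (λ z → agree (side k z))
      where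
      agree : ∀ {z} → Side k z → z ∈ Z ⇔ z ∈ union X Y
      agree (left x)  = ⇔-sym (inl∈union X Y) ⇔-∘ l x
      agree (right y) = ⇔-sym (inr∈union X Y) ⇔-∘ r y

    union-surjective : ∀ Z → ∃[ X ] ∃[ Y ] Z ≡ union X Y
    union-surjective Z = ⟪ (λ x → inl k x ∈? Z) ⟫ , ⟪ (λ y → inr k y ∈? Z) ⟫ ,
      union-unique _ _ (λ x → ⇔-sym (∈-⟪⟫ _)) (λ y → ⇔-sym (∈-⟪⟫ _))

    Meet-union : ∀ X X′ Y Y′ → Meet (union X Y) (union X′ Y′) ⇔ (Meet X X′ ⊎ Meet Y Y′)
    Meet-union X X′ Y Y′ = mk⇔ fwd bwd
      where
      fwd : Meet (union X Y) (union X′ Y′) → Meet X X′ ⊎ Meet Y Y′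
      fwd (z , p , q) with side k z
      ... | left x  = inj₁ (x , ⇒ (inl∈union X Y) p , ⇒ (inl∈union X′ Y′) q)
      ... | right y = inj₂ (y , ⇒ (inr∈union X Y) p , ⇒ (inr∈union X′ Y′) q)
      bwd : Meet X X′ ⊎ Meet Y Y′ → Meet (union X Y) (union X′ Y′)
      bwd (inj₁ (x , p , q)) = _ , ⇐ (inl∈union X Y) p , ⇐ (inl∈union X′ Y′) q
      bwd (inj₂ (y , p , q)) = _ , ⇐ (inr∈union X Y) p , ⇐ (inr∈union X′ Y′) q

  module _ {k l} {f : Elt k G → Elt l G} {g : Elt k H → Elt l H} {h : Elt k (G ⊞ H) → Elt l (G ⊞ H)}
           (h-inl : ∀ x → h (inl k x) ≡ inl l (f x)) (h-inr : ∀ y → h (inr k y) ≡ inr l (g y)) where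

    -- By the two hypotheses `h` never crosses from one summand to the other, so each element of an
    -- image has its preimages on its own side.
    image-union : ∀ X Y → image h (union k X Y) ≡ union l (image f X) (image g Y)
    image-union X Y = union-unique l _ _
      (λ x → ⇔-sym (∈-image f X) ⇔-∘ (mk⇔ lˡ lʳ ⇔-∘ ∈-image h _))
      (λ y → ⇔-sym (∈-image g Y) ⇔-∘ (mk⇔ rˡ rʳ ⇔-∘ ∈-image h _))
      where
      lˡ : ∀ {x} → (∃[ z ] z ∈ union k X Y × h z ≡ inl l x) → ∃[ w ] w ∈ X × f w ≡ x
      lˡ (z , z∈ , e) with side k z
      ... | left w  = w , ⇒ (inl∈union k X Y) z∈ , inl-injective l (trans (sym (h-inl w)) e)
      ... | right w = contradiction (trans (sym e) (h-inr w)) (inl≢inr l)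
      lʳ : ∀ {x} → (∃[ w ] w ∈ X × f w ≡ x) → ∃[ z ] z ∈ union k X Y × h z ≡ inl l x
      lʳ (w , w∈ , refl) = _ , ⇐ (inl∈union k X Y) w∈ , h-inl w
      rˡ : ∀ {y} → (∃[ z ] z ∈ union k X Y × h z ≡ inr l y) → ∃[ w ] w ∈ Y × g w ≡ y
      rˡ (z , z∈ , e) with side k z
      ... | left w  = contradiction (trans (sym (h-inl w)) e) (inl≢inr l)
      ... | right w = w , ⇒ (inr∈union k X Y) z∈ , inr-injective l (trans (sym (h-inr w)) e)
      rʳ : ∀ {y} → (∃[ w ] w ∈ Y × g w ≡ y) → ∃[ z ] z ∈ union k X Y × h z ≡ inr l y
      rʳ (w , w∈ , refl) = _ , ⇐ (inr∈union k X Y) w∈ , h-inr w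

-- Surjections of graphs and the kernel of a fusion

-- A common form of isomorphisms and fusions: maps on vertices and on edges that transport the
-- words, with chosen sections. The sections make every set of the target an image.
record Epi (G H : Graph) : Set where
  field
    on         : ∀ k → Elt k G → Elt k H
    lift       : ∀ k → Elt k H → Elt k G
    on∘lift    : ∀ k y → on k (lift k y) ≡ y
    on-ends    : ∀ e → List⁺.map (on V) (Graph.ends G e) ≡ Graph.ends H (on E e)

open Epi

≅⇒Epi : ∀ {n} {G H : TypedGraph n} → G ≅ H → Epi (graph G) (graph H)
≅⇒Epi i = record
  { on         = λ { V → to I.vertices ; E → to I.edges }
  ; lift       = λ { V → from I.vertices ; E → from I.edges }
  ; on∘lift    = λ { V → strictlyInverseˡ I.vertices ; E → strictlyInverseˡ I.edges }
  ; on-ends    = I.ends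
  }
  where module I = _≅_ i

≅⇒Epi-injective : ∀ {n} {G H : TypedGraph n} (i : G ≅ H) k {x y} →
                  on (≅⇒Epi i) k x ≡ on (≅⇒Epi i) k y → x ≡ y
≅⇒Epi-injective i V = Injection.injective (↔⇒↣ (_≅_.vertices i))
≅⇒Epi-injective i E = Injection.injective (↔⇒↣ (_≅_.edges i))

fuseEpi : ∀ {n} (a b : Fin n) (G : TypedGraph n) → Epi (graph G) (graph (fuse a b G))
fuseEpi a b G = record
  { on         = λ { V → proj₂ (identify (G.terminal a) (G.terminal b)) ; E → id }
  ; lift       = λ { V → Q.section ; E → id }
  ; on∘lift    = λ { V → Q.q∘section ; E _ → refl }
  ; on-ends    = λ e → refl
  }
  where
  module G = TypedGraph G
  module Q = IsIdentification (identify-isIdentification (G.terminal a) (G.terminal b))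

Glued : ∀ {A : Set} → A → A → A → A → Set
Glued u v x y = x ≡ y ⊎ (x ≡ u × y ≡ v) ⊎ (x ≡ v × y ≡ u)

-- Apply `section` to `q x ≡ q y`: it returns each argument itself, or `u` in place of `v`. The four
-- resulting cases give the three ways of being `Glued`.
identification-kernel : ∀ {m n} {u v : Fin m} {q : Fin m → Fin n} → IsIdentification u v q →
                        ∀ {x y} → q x ≡ q y ⇔ Glued u v x y
identification-kernel {u = u} {v} {q} Q {x} {y} = mk⇔
  (fwd (section∘q x) (section∘q y) ∘ cong section) bwd
  where
  open IsIdentification Q
  fwd : section (q x) ≡ x ⊎ (section (q x) ≡ u × x ≡ v) → section (q y) ≡ y ⊎ (section (q y) ≡ u × y ≡ v) →
        section (q x) ≡ section (q y) → Glued u v x y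
  fwd (inj₁ p)       (inj₁ r)       e = inj₁ (trans (sym p) (trans e r))
  fwd (inj₁ p)       (inj₂ (r , s)) e = inj₂ (inj₁ (trans (sym p) (trans e r) , s))
  fwd (inj₂ (p , s)) (inj₁ r)       e = inj₂ (inj₂ (s , trans (sym r) (trans (sym e) p)))
  fwd (inj₂ (_ , s)) (inj₂ (_ , t)) e = inj₁ (trans s (sym t))
  bwd : Glued u v x y → q x ≡ q y
  bwd (inj₁ refl)                = refl
  bwd (inj₂ (inj₁ (refl , refl))) = glues
  bwd (inj₂ (inj₂ (refl , refl))) = sym glues

-- End points, terms and core formulas

nth : ∀ {A : Set} → ℕ → A → List A → A
nth _       d []       = d
nth zero    d (x ∷ _)  = x
nth (suc j) d (_ ∷ xs) = nth j d xs

nth-map : ∀ {A B : Set} (f : A → B) j d xs → nth j (f d) (List.map f xs) ≡ f (nth j d xs)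
nth-map f j       d []       = refl
nth-map f zero    d (x ∷ xs) = refl
nth-map f (suc j) d (x ∷ xs) = nth-map f j d xs

-- Words are nonempty, so the head is available as a default and the function is total. Mapping a
-- word maps its head, so the default respects naturality.
endpoint : ∀ {G} → ℕ → Elt E G → Elt V G
endpoint {G} j e = nth j (List⁺.head (Graph.ends G e)) (toList (Graph.ends G e))

nth-map⁺ : ∀ {A B : Set} (f : A → B) j (w : List⁺ A) {w′} → List⁺.map f w ≡ w′ →
           nth j (List⁺.head w′) (toList w′) ≡ f (nth j (List⁺.head w) (toList w))
nth-map⁺ f j (x ∷ xs) refl = nth-map f j x (x ∷ xs)

endpoint-natural : ∀ {G H} (f : ∀ k → Elt k G → Elt k H) →
  (∀ e → List⁺.map (f V) (Graph.ends G e) ≡ Graph.ends H (f E e)) →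
  ∀ j e → endpoint {H} j (f E e) ≡ f V (endpoint {G} j e)
endpoint-natural f f-ends j e = nth-map⁺ (f V) j _ (f-ends e)

-- `len m` is the set of edges of length m, and `end j t` the set of j-th end
-- points of the edges in t, counted from 0; if an edge has at most j end points,
-- its first one is taken instead.

data Term (Γ : List Kind) : Kind → Set where
  var : ∀ {k} → k ∈ˡ Γ → Term Γ k
  len : ℕ → Term Γ E
  end : ℕ → Term Γ E → Term Γ V

infix  6 _meets_
infixr 5 _∧ᶜ_
infixr 4 _⇒ᶜ_

data Core (Γ : List Kind) : Set where
  _meets_   : ∀ {k} → Term Γ k → Term Γ k → Core Γ
  ⊥ᶜ        : Core Γ
  _∧ᶜ_ _⇒ᶜ_ : Core Γ → Core Γ → Core Γ
  ∀ᶜ        : ∀ k → Core (k ∷ Γ) → Core Γ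

Env : List Kind → Graph → Set
Env Γ G = All (λ k → Subset (count k G)) Γ

eval-term : ∀ {Γ k} → Term Γ k → ∀ G → Env Γ G → Subset (count k G)
eval-term (var x)   G η = All.lookup η x
eval-term (len m)   G η = ⟪ (λ e → List⁺.length (Graph.ends G e) ℕ.≟ m) ⟫
eval-term (end j t) G η = image (endpoint {G} j) (eval-term t G η)

_,_⊨_ : ∀ {Γ} G → Env Γ G → Core Γ → Set
G , η ⊨ (t meets u) = Meet (eval-term t G η) (eval-term u G η)
G , η ⊨ ⊥ᶜ          = ⊥
G , η ⊨ (φ ∧ᶜ ψ)    = (G , η ⊨ φ) × (G , η ⊨ ψ)
G , η ⊨ (φ ⇒ᶜ ψ)    = (G , η ⊨ φ) → (G , η ⊨ ψ)
G , η ⊨ ∀ᶜ k φ      = ∀ X → G , X ∷ η ⊨ φ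

infixr 6 _⊔ᴱ_

_⊔ᴱ_ : ∀ {Γ G H} → Env Γ G → Env Γ H → Env Γ (G ⊞ H)
[]      ⊔ᴱ []      = []
_⊔ᴱ_ {k ∷ _} {G} {H} (X ∷ η) (Y ∷ θ) = Union.union G H k X Y ∷ η ⊔ᴱ θ

push : ∀ {Γ G H} → Epi G H → Env Γ G → Env Γ H
push p = All.map (λ {k} → image (on p k))

image-commute : ∀ {a b c d} {f : Fin b → Fin d} {g : Fin a → Fin b} {h : Fin c → Fin d} {i : Fin a → Fin c} →
                (∀ x → f (g x) ≡ h (i x)) → ∀ X → image f (image g X) ≡ image h (image i X)
image-commute {f = f} {g} {h} {i} fg≗hi X = ⊆⊇⇒≡ λ y → mk⇔ (swap f g h i fg≗hi) (swap h i f g (sym ∘ fg≗hi))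
  where
  swap : ∀ {a b c d} {X : Subset a} (f : Fin b → Fin d) (g : Fin a → Fin b)
         (h : Fin c → Fin d) (i : Fin a → Fin c) →
         (∀ x → f (g x) ≡ h (i x)) → ∀ {y} → y ∈ image f (image g X) → y ∈ image h (image i X)
  swap f g h i e y∈ with ⇒ (∈-image f _) y∈
  ... | z , z∈ , refl with ⇒ (∈-image g _) z∈
  ... | x , x∈ , refl = ⇐ (∈-image h _) (_ , ⇐ (∈-image i _) (x , x∈ , refl) , sym (e x))

length-map⁺ : ∀ {A B : Set} (f : A → B) (w : List⁺ A) {w′} → List⁺.map f w ≡ w′ →
              List⁺.length w′ ≡ List⁺.length w
length-map⁺ f w refl = List⁺.length-map f w

module _ {G H : Graph} where
  open Union G H

  lookup-⊔ : ∀ {Γ k} (x : k ∈ˡ Γ) (η : Env Γ G) (θ : Env Γ H) →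
             All.lookup (η ⊔ᴱ θ) x ≡ union k (All.lookup η x) (All.lookup θ x)
  lookup-⊔ (here refl) (_ ∷ _) (_ ∷ _) = refl
  lookup-⊔ (there x)   (_ ∷ η) (_ ∷ θ) = lookup-⊔ x η θ

  -- The word of an edge is, up to renaming of vertices, the word that it has in its own summand, so
  -- its length and end points are determined there.
  eval-term-⊔ : ∀ {Γ k} (t : Term Γ k) (η : Env Γ G) (θ : Env Γ H) →
                eval-term t (G ⊞ H) (η ⊔ᴱ θ) ≡ union k (eval-term t G η) (eval-term t H θ)
  eval-term-⊔ (var x) η θ = lookup-⊔ x η θ
  eval-term-⊔ (len m) η θ = union-unique E _ _
    (λ e → ⇔-sym (∈-⟪⟫ _) ⇔-∘ (same-length (length-map⁺ (inl V) _ (ends-inl e)) ⇔-∘ ∈-⟪⟫ _))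
    (λ e → ⇔-sym (∈-⟪⟫ _) ⇔-∘ (same-length (length-map⁺ (inr V) _ (ends-inr e)) ⇔-∘ ∈-⟪⟫ _))
    where
    same-length : ∀ {a b} → a ≡ b → (a ≡ m) ⇔ (b ≡ m)
    same-length refl = ⇔-id _
  eval-term-⊔ (end j t) η θ = trans (cong (image (endpoint {G ⊞ H} j)) (eval-term-⊔ t η θ))
    (image-union {E} {V} (endpoint-natural {G} {G ⊞ H} inl ends-inl j)
                         (endpoint-natural {H} {G ⊞ H} inr ends-inr j) (eval-term t G η) (eval-term t H θ))

-- For `len`, lengths are preserved and every edge of the target is reached from its lift, which has
-- the same length; for `end`, naturality of `endpoint` lets the two images be interchanged.
eval-term-push : ∀ {Γ k} (t : Term Γ k) {G H} (p : Epi G H) (η : Env Γ G) →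
                 eval-term t H (push p η) ≡ image (on p k) (eval-term t G η)
eval-term-push (var x) p η = lookup-push x η
  where
  lookup-push : ∀ {Γ k} (x : k ∈ˡ Γ) η → All.lookup (push p η) x ≡ image (on p k) (All.lookup η x)
  lookup-push (here refl) (_ ∷ _) = refl
  lookup-push (there x)   (_ ∷ η) = lookup-push x η
eval-term-push (len m) {G} {H} p η = ⊆⊇⇒≡ λ e → mk⇔ (fwd e) bwd
  where
  same-length : ∀ e → List⁺.length (Graph.ends H (on p E e)) ≡ List⁺.length (Graph.ends G e)
  same-length e = length-map⁺ (on p V) (Graph.ends G e) (on-ends p e)
  fwd : ∀ e → e ∈ eval-term (len m) H (push p η) → e ∈ image (on p E) (eval-term (len m) G η)
  fwd e e∈ = ⇐ (∈-image _ _) (lift p E e ,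
    ⇐ (∈-⟪⟫ _) (trans (sym (same-length _))
        (trans (cong (List⁺.length ∘ Graph.ends H) (on∘lift p E e)) (⇒ (∈-⟪⟫ _) e∈))) ,
    on∘lift p E e)
  bwd : ∀ {e} → e ∈ image (on p E) (eval-term (len m) G η) → e ∈ eval-term (len m) H (push p η)
  bwd e∈ with ⇒ (∈-image (on p E) (eval-term (len m) G η)) e∈
  ... | e , e∈len , refl = ⇐ (∈-⟪⟫ _) (trans (same-length e) (⇒ (∈-⟪⟫ _) e∈len))
eval-term-push (end j t) {G} {H} p η = trans (cong (image (endpoint {H} j)) (eval-term-push t p η))
  (image-commute (endpoint-natural {G} {H} (on p) (on-ends p) j) (eval-term t G η))

-- Finite congruences on labelled graphs

-- The laws make `state` a homomorphism on labelled graphs: labels are joined by `⊔ᴱ` in a sum, kept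
-- by a redefinition, and pushed forward along fusions and isomorphisms.
record Observation (Γ : List Kind) : Set₁ where
  field
    State   : ℕ → Set
    states  : ∀ n → Finite (State n)
    state   : ∀ {n} (G : TypedGraph n) → Env Γ (graph G) → State n
    sumˢ    : ∀ {n m} → State n → State m → State (n + m)
    redefˢ  : ∀ {n m} → (Fin n → Fin m) → State m → State n
    fuseˢ   : ∀ {n} → Fin n → Fin n → State n → State n
    state-⊕ : ∀ {n m} (G : TypedGraph n) (H : TypedGraph m) η θ →
              state (G ⊕ H) (η ⊔ᴱ θ) ≡ sumˢ (state G η) (state H θ)
    state-redefine : ∀ {n m} (σ : Fin n → Fin m) G η →
                     state (redefine σ G) η ≡ redefˢ σ (state G η)
    state-fuse     : ∀ {n} (a b : Fin n) G η →
                     state (fuse a b G) (push (fuseEpi a b G) η) ≡ fuseˢ a b (state G η)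
    state-≅        : ∀ {n} {G H : TypedGraph n} (i : G ≅ H) η →
                     state H (push (≅⇒Epi i) η) ≡ state G η

record Recogniser {Γ} (φ : Core Γ) : Set₁ where
  field
    observation : Observation Γ
  open Observation observation public
  field
    Accept  : ∀ {n} → State n → Set
    correct : ∀ {n} (G : TypedGraph n) η → (graph G , η ⊨ φ) ⇔ Accept (state G η)

infixr 2 _⊗_

_⊗_ : ∀ {Γ} → Observation Γ → Observation Γ → Observation Γ
A ⊗ B = record
  { State          = λ n → A.State n × B.State n
  ; states         = λ n → Finite-× (A.states n) (B.states n)
  ; state          = λ G η → A.state G η , B.state G η
  ; sumˢ           = λ (x , y) (x′ , y′) → A.sumˢ x x′ , B.sumˢ y y′
  ; redefˢ         = λ σ (x , y) → A.redefˢ σ x , B.redefˢ σ y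
  ; fuseˢ          = λ a b (x , y) → A.fuseˢ a b x , B.fuseˢ a b y
  ; state-⊕        = λ G H η θ → cong₂ _,_ (A.state-⊕ G H η θ) (B.state-⊕ G H η θ)
  ; state-redefine = λ σ G η → cong₂ _,_ (A.state-redefine σ G η) (B.state-redefine σ G η)
  ; state-fuse     = λ a b G η → cong₂ _,_ (A.state-fuse a b G η) (B.state-fuse a b G η)
  ; state-≅        = λ i η → cong₂ _,_ (A.state-≅ i η) (B.state-≅ i η)
  }
  where
  module A = Observation A
  module B = Observation B

trivial : ∀ {Γ} → Observation Γ
trivial = record
  { State = λ _ → ⊤ ; states = λ _ → finite (↔-sym 1↔⊤)
  ; state = _ ; sumˢ = _ ; redefˢ = _ ; fuseˢ = _
  ; state-⊕ = λ _ _ _ _ → refl ; state-redefine = λ _ _ _ → refl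
  ; state-fuse = λ _ _ _ _ → refl ; state-≅ = λ _ _ → refl
  }

-- The powerset construction for a quantifier

module _ {k Γ} (A : Observation (k ∷ Γ)) where
  open Observation A

  private
    Family : ℕ → Set
    Family n = Powerset (states n)

    Extension : ∀ {n} (G : TypedGraph n) → Env Γ (graph G) → State n → Set
    Extension G η a = ∃[ X ] state G (X ∷ η) ≡ a

    extension? : ∀ {n} (G : TypedGraph n) η a → Dec (Extension G η a)
    extension? G η a = anySubset? (λ X → eq? (states _) (state G (X ∷ η)) a)

    extensions : ∀ {n} (G : TypedGraph n) → Env Γ (graph G) → Family n
    extensions G η = comprehension (states _) (extension? G η)

    ∈-extensions : ∀ {n} (G : TypedGraph n) η {a} → member (states n) a (extensions G η) ⇔ Extension G η a
    ∈-extensions G η = member-comprehension (states _) (extension? G η)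

    Direct : ∀ {n m} → (State n → State m) → Family n → State m → Set
    Direct f S c = ∃[ a ] member (states _) a S × f a ≡ c

    direct? : ∀ {n m} (f : State n → State m) S c → Dec (Direct f S c)
    direct? f S c = search (states _) (λ a → member? (states _) a S ×-dec eq? (states _) (f a) c)

    Direct₂ : ∀ {n m l} → (State n → State m → State l) → Family n → Family m → State l → Set
    Direct₂ f S T c = ∃[ a ] (member (states _) a S × Direct (f a) T c)

    direct₂? : ∀ {n m l} (f : State n → State m → State l) S T c → Dec (Direct₂ f S T c)
    direct₂? f S T c = search (states _) (λ a → member? (states _) a S ×-dec direct? (f a) T c)

    module _ {n m} {G : TypedGraph n} {H : TypedGraph m} {η : Env Γ (graph G)} {θ : Env Γ (graph H)}
             (f : State n → State m) (g : Subset (count k (graph G)) → Subset (count k (graph H)))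
             (g-surjective : ∀ Y → ∃[ X ] g X ≡ Y)
             (f-state : ∀ X → state H (g X ∷ θ) ≡ f (state G (X ∷ η))) where

      -- By surjectivity every label of `H` has the form `g X`, and `f-state` computes its state
      -- from the state of `G` labelled by `X`.
      transfer : ∀ c → Extension H θ c ⇔ (∃[ X ] f (state G (X ∷ η)) ≡ c)
      transfer c = mk⇔ fwd (λ { (X , refl) → g X , f-state X })
        where
        fwd : Extension H θ c → ∃[ X ] f (state G (X ∷ η)) ≡ c
        fwd (Y , refl) with g-surjective Y
        ... | X , refl = X , sym (f-state X)

      transfer-direct : ∀ c → Extension H θ c ⇔ Direct f (extensions G η) c
      transfer-direct c = mk⇔
        (λ { (X , e) → state G (X ∷ η) , ⇐ (∈-extensions G η) (X , refl) , e })
        (λ { (a , a∈ , e) → let X , Xa = ⇒ (∈-extensions G η) a∈ in X , trans (cong f Xa) e })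
        ⇔-∘ transfer c

  -- The state of a graph is the set of states reached by some choice of the innermost label, and
  -- operations act by direct images. The laws hold because labels of the arguments yield a label of
  -- the result and every label of the result arises so.
  power : Observation Γ
  power = record
    { State          = Family
    ; states         = λ n → Finite-Subset _
    ; state          = extensions
    ; sumˢ           = λ S T → comprehension (states _) (direct₂? sumˢ S T)
    ; redefˢ         = λ σ S → comprehension (states _) (direct? (redefˢ σ) S)
    ; fuseˢ          = λ a b S → comprehension (states _) (direct? (fuseˢ a b) S)
    ; state-⊕        = λ {n} {m} G H η θ → comprehension-cong (states _)
                         (extension? (G ⊕ H) (η ⊔ᴱ θ)) (direct₂? sumˢ _ _)
                         (λ c → mk⇔ (split G H η θ) (merge G H η θ))
    ; state-redefine = λ σ G η → comprehension-cong (states _)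
                         (extension? (redefine σ G) η) (direct? (redefˢ σ) _)
                         (transfer-direct (redefˢ σ) id (λ X → X , refl) (λ X → state-redefine σ G (X ∷ η)))
    ; state-fuse     = λ a b G η → comprehension-cong (states _)
                         (extension? (fuse a b G) _) (direct? (fuseˢ a b) _)
                         (transfer-direct (fuseˢ a b) (image _) (push-surjective (fuseEpi a b G))
                           (λ X → state-fuse a b G (X ∷ η)))
    ; state-≅        = λ {n} {G} {H} i η → comprehension-cong (states _)
                         (extension? H _) (extension? G η)
                         (transfer id (image _) (push-surjective (≅⇒Epi i)) (λ X → state-≅ i (X ∷ η)))
    }
    where
    push-surjective : ∀ {G H} (p : Epi G H) Y → ∃[ X ] image (on p k) X ≡ Y
    push-surjective p = image-surjective (on p k) (lift p k) (on∘lift p k)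
    module _ {n m} (G : TypedGraph n) (H : TypedGraph m)
             (η : Env Γ (graph G)) (θ : Env Γ (graph H)) {c : State (n + m)} where
      split : Extension (G ⊕ H) (η ⊔ᴱ θ) c → Direct₂ sumˢ (extensions G η) (extensions H θ) c
      -- A label of the sum is the union of its restrictions to the two summands.
      split (Z , refl) with Union.union-surjective (graph G) (graph H) k Z
      ... | X , Y , refl = state G (X ∷ η) , ⇐ (∈-extensions G η) (X , refl) ,
                           state H (Y ∷ θ) , ⇐ (∈-extensions H θ) (Y , refl) ,
                           sym (state-⊕ G H (X ∷ η) (Y ∷ θ))
      merge : Direct₂ sumˢ (extensions G η) (extensions H θ) c → Extension (G ⊕ H) (η ⊔ᴱ θ) c
      merge (a , a∈ , b , b∈ , refl) with ⇒ (∈-extensions G η) a∈ | ⇒ (∈-extensions H θ) b∈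
      ... | X , refl | Y , refl = _ , state-⊕ G H (X ∷ η) (Y ∷ θ)

  member-power : ∀ {n} (G : TypedGraph n) η {a} →
                 member (states n) a (Observation.state power G η) ⇔ (∃[ X ] state G (X ∷ η) ≡ a)
  member-power = ∈-extensions

-- Queries about the meeting of two sets

infixr 6 _∧⁺_
infixr 5 _∨⁺_

-- An answer about a compound graph is such a combination of answers about its arguments. It is kept
-- as syntax so that one combination can be evaluated both on the true answers and on a stored
-- state.
data Positive (A : Set) : Set where
  at        : A → Positive A
  ⊥⁺        : Positive A
  _∧⁺_ _∨⁺_ : Positive A → Positive A → Positive A

module _ {A : Set} where

  _⊩_ : Pred A 0ℓ → Positive A → Set
  P ⊩ at a     = P a
  P ⊩ ⊥⁺       = ⊥
  P ⊩ (x ∧⁺ y) = (P ⊩ x) × (P ⊩ y)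
  P ⊩ (x ∨⁺ y) = (P ⊩ x) ⊎ (P ⊩ y)

  ⊩? : ∀ {P} → Decidable P → Decidable (P ⊩_)
  ⊩? P? (at a)   = P? a
  ⊩? P? ⊥⁺       = no λ ()
  ⊩? P? (x ∧⁺ y) = ⊩? P? x ×-dec ⊩? P? y
  ⊩? P? (x ∨⁺ y) = ⊩? P? x ⊎-dec ⊩? P? y

  ⊩-cong : ∀ {P Q : Pred A 0ℓ} → (∀ a → P a ⇔ Q a) → ∀ x → (P ⊩ x) ⇔ (Q ⊩ x)
  ⊩-cong P⇔Q (at a)   = P⇔Q a
  ⊩-cong P⇔Q ⊥⁺       = ⇔-id _
  ⊩-cong P⇔Q (x ∧⁺ y) = ⊩-cong P⇔Q x ×-⇔ ⊩-cong P⇔Q y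
  ⊩-cong P⇔Q (x ∨⁺ y) = ⊩-cong P⇔Q x ⊎-⇔ ⊩-cong P⇔Q y

-- Fusing two terminals can make disjoint vertex sets meet, so membership of the
-- terminals in both sets and their coincidences have to be known as well.

data Query : Kind → ℕ → Set where
  met     : ∀ {k n} → Query k n
  in₁ in₂ : ∀ {n} → Fin n → Query V n
  same    : ∀ {n} → Fin n → Fin n → Query V n

queries : ∀ k n → Finite (Query k n)
queries V n = finite
  (↔-sym (+↔⊎ {1} {n + (n + n * n)}) ↔-∘
   ((mk↔ₛ′ (λ _ → zero) _ (λ { zero → refl }) (λ _ → refl) ⊎-↔
    (↔-sym +↔⊎ ↔-∘ (↔-id _ ⊎-↔ (↔-sym +↔⊎ ↔-∘ (↔-id _ ⊎-↔ ↔-sym *↔×))))) ↔-∘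
   mk↔ₛ′ code decode code∘decode decode∘code))
  where
  code : Query V n → ⊤ ⊎ Fin n ⊎ Fin n ⊎ (Fin n × Fin n)
  code met        = inj₁ tt
  code (in₁ c)    = inj₂ (inj₁ c)
  code (in₂ c)    = inj₂ (inj₂ (inj₁ c))
  code (same c d) = inj₂ (inj₂ (inj₂ (c , d)))
  decode : ⊤ ⊎ Fin n ⊎ Fin n ⊎ (Fin n × Fin n) → Query V n
  decode (inj₁ tt)                     = met
  decode (inj₂ (inj₁ c))               = in₁ c
  decode (inj₂ (inj₂ (inj₁ c)))        = in₂ c
  decode (inj₂ (inj₂ (inj₂ (c , d))))  = same c d
  code∘decode : ∀ x → code (decode x) ≡ x
  code∘decode (inj₁ tt)                 = refl
  code∘decode (inj₂ (inj₁ _))           = refl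
  code∘decode (inj₂ (inj₂ (inj₁ _)))    = refl
  code∘decode (inj₂ (inj₂ (inj₂ _)))    = refl
  decode∘code : ∀ q → decode (code q) ≡ q
  decode∘code met        = refl
  decode∘code (in₁ _)    = refl
  decode∘code (in₂ _)    = refl
  decode∘code (same _ _) = refl
queries E n = finite {card = 1} (mk↔ₛ′ (λ _ → zero) (λ _ → met) (λ { zero → refl }) (λ { met → refl }))

sumQ : ∀ {k} n {m} → Query k (n + m) → Positive (Query k n ⊎ Query k m)
sumQ n met        = at (inj₁ met) ∨⁺ at (inj₂ met)
sumQ n (in₁ c)    = at (Sum.map in₁ in₁ (splitAt n c))
sumQ n (in₂ c)    = at (Sum.map in₂ in₂ (splitAt n c))
sumQ n (same c d) = both (splitAt n c) (splitAt n d)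
  where
  both : ∀ {n m} → Fin n ⊎ Fin m → Fin n ⊎ Fin m → Positive (Query V n ⊎ Query V m)
  both (inj₁ c) (inj₁ d) = at (inj₁ (same c d))
  both (inj₂ c) (inj₂ d) = at (inj₂ (same c d))
  -- Terminals from different summands are distinct vertices of the sum.
  both _        _        = ⊥⁺

redefQ : ∀ {k n m} → (Fin n → Fin m) → Query k n → Query k m
redefQ σ met        = met
redefQ σ (in₁ c)    = in₁ (σ c)
redefQ σ (in₂ c)    = in₂ (σ c)
redefQ σ (same c d) = same (σ c) (σ d)

-- Two vertices become equal if they were equal already or are the two fused ones, in either order;
-- this gives the three disjuncts for vertices. Edges are left alone by a fusion.
fuseQ : ∀ {k n} → Fin n → Fin n → Query k n → Positive (Query k n)
fuseQ {V} a b met        = at met ∨⁺ (at (in₁ a) ∧⁺ at (in₂ b)) ∨⁺ (at (in₁ b) ∧⁺ at (in₂ a))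
fuseQ {E} a b met        = at met
fuseQ     a b (in₁ c)    = at (in₁ c) ∨⁺ (at (same c a) ∧⁺ at (in₁ b)) ∨⁺ (at (same c b) ∧⁺ at (in₁ a))
fuseQ     a b (in₂ c)    = at (in₂ c) ∨⁺ (at (same c a) ∧⁺ at (in₂ b)) ∨⁺ (at (same c b) ∧⁺ at (in₂ a))
fuseQ     a b (same c d) = at (same c d)
                             ∨⁺ (at (same c a) ∧⁺ at (same d b)) ∨⁺ (at (same c b) ∧⁺ at (same d a))

module _ {m n} {f : Fin m → Fin n} where

  Meet-image : (∀ {x y} → f x ≡ f y → x ≡ y) → ∀ X Y → Meet (image f X) (image f Y) ⇔ Meet X Y
  Meet-image inj X Y = mk⇔ fwd
    (λ (x , p , q) → f x , ⇐ (∈-image f X) (x , p , refl) , ⇐ (∈-image f Y) (x , q , refl))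
    where
    fwd : Meet (image f X) (image f Y) → Meet X Y
    fwd (_ , p , q) with ⇒ (∈-image f X) p | ⇒ (∈-image f Y) q
    ... | x , x∈ , e | y , y∈ , e′ = x , x∈ , subst (_∈ Y) (inj (trans e′ (sym e))) y∈

  ∈-image-injective : (∀ {x y} → f x ≡ f y → x ≡ y) → ∀ X {x} → f x ∈ image f X ⇔ x ∈ X
  ∈-image-injective inj X = mk⇔ (λ p → let y , y∈ , e = ⇒ (∈-image f X) p in subst (_∈ X) (inj e) y∈)
                                (λ p → ⇐ (∈-image f X) (_ , p , refl))

  module _ {u v : Fin m} (Q : IsIdentification u v f) where

    -- A common point of the images comes from some `x` in `X` and `y` in `Y` with the same image;
    -- the kernel of the identification leaves three possibilities for this pair, one for each
    -- disjunct.
    Meet-identification : ∀ X Y →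
                          Meet (image f X) (image f Y) ⇔ (Meet X Y ⊎ (u ∈ X × v ∈ Y) ⊎ (v ∈ X × u ∈ Y))
    Meet-identification X Y = mk⇔ fwd bwd
      where
      fwd : Meet (image f X) (image f Y) → Meet X Y ⊎ (u ∈ X × v ∈ Y) ⊎ (v ∈ X × u ∈ Y)
      fwd (_ , p , q) with ⇒ (∈-image f X) p | ⇒ (∈-image f Y) q
      ... | x , x∈ , e | y , y∈ , e′ with ⇒ (identification-kernel Q) (trans e (sym e′))
      ... | inj₁ refl                 = inj₁ (x , x∈ , y∈)
      ... | inj₂ (inj₁ (refl , refl)) = inj₂ (inj₁ (x∈ , y∈))
      ... | inj₂ (inj₂ (refl , refl)) = inj₂ (inj₂ (x∈ , y∈))
      meet : ∀ {x y} → x ∈ X → y ∈ Y → Glued u v x y → Meet (image f X) (image f Y)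
      meet {x} x∈ y∈ g = f x , ⇐ (∈-image f X) (_ , x∈ , refl) ,
                         ⇐ (∈-image f Y) (_ , y∈ , sym (⇐ (identification-kernel Q) g))
      bwd : Meet X Y ⊎ (u ∈ X × v ∈ Y) ⊎ (v ∈ X × u ∈ Y) → Meet (image f X) (image f Y)
      bwd (inj₁ (x , p , q))    = meet p q (inj₁ refl)
      bwd (inj₂ (inj₁ (p , q))) = meet p q (inj₂ (inj₁ (refl , refl)))
      bwd (inj₂ (inj₂ (p , q))) = meet p q (inj₂ (inj₂ (refl , refl)))

    ∈-identification : ∀ X {w} → f w ∈ image f X ⇔ (w ∈ X ⊎ (w ≡ u × v ∈ X) ⊎ (w ≡ v × u ∈ X))
    ∈-identification X {w} = mk⇔ fwd bwd
      where
      fwd : f w ∈ image f X → w ∈ X ⊎ (w ≡ u × v ∈ X) ⊎ (w ≡ v × u ∈ X)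
      fwd p with ⇒ (∈-image f X) p
      ... | x , x∈ , e with ⇒ (identification-kernel Q) (sym e)
      ... | inj₁ refl                 = inj₁ x∈
      ... | inj₂ (inj₁ (w≡u , refl)) = inj₂ (inj₁ (w≡u , x∈))
      ... | inj₂ (inj₂ (w≡v , refl)) = inj₂ (inj₂ (w≡v , x∈))
      member-of : ∀ {x} → x ∈ X → Glued u v w x → f w ∈ image f X
      member-of x∈ g = ⇐ (∈-image f X) (_ , x∈ , sym (⇐ (identification-kernel Q) g))
      bwd : w ∈ X ⊎ (w ≡ u × v ∈ X) ⊎ (w ≡ v × u ∈ X) → f w ∈ image f X
      bwd (inj₁ p)              = member-of p (inj₁ refl)
      bwd (inj₂ (inj₁ (e , p))) = member-of p (inj₂ (inj₁ (e , refl)))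
      bwd (inj₂ (inj₂ (e , p))) = member-of p (inj₂ (inj₂ (e , refl)))

Answer : ∀ k {n} (G : TypedGraph n) (X Y : Subset (count k (graph G))) → Query k n → Set
Answer k G X Y met        = Meet X Y
Answer V G X Y (in₁ c)    = terminal G c ∈ X
Answer V G X Y (in₂ c)    = terminal G c ∈ Y
Answer V G X Y (same c d) = terminal G c ≡ terminal G d

answer? : ∀ k {n} (G : TypedGraph n) (X Y : Subset (count k (graph G))) → Decidable (Answer k G X Y)
answer? k G X Y met        = meet? X Y
answer? V G X Y (in₁ c)    = terminal G c ∈? X
answer? V G X Y (in₂ c)    = terminal G c ∈? Y
answer? V G X Y (same c d) = terminal G c ≟ terminal G d

module _ {n m} (G : TypedGraph n) (H : TypedGraph m) where
  open Union (graph G) (graph H)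

  Answer-⊕ : ∀ k X Y X′ Y′ (q : Query k (n + m)) →
             Answer k (G ⊕ H) (union k X X′) (union k Y Y′) q ⇔
             ([ Answer k G X Y , Answer k H X′ Y′ ]′ ⊩ sumQ n q)
  Answer-⊕ k X Y X′ Y′ met = Meet-union k X Y X′ Y′
  Answer-⊕ V X Y X′ Y′ (in₁ c) with splitAt n c
  ... | inj₁ _ = inl∈union V X X′
  ... | inj₂ _ = inr∈union V X X′
  Answer-⊕ V X Y X′ Y′ (in₂ c) with splitAt n c
  ... | inj₁ _ = inl∈union V Y Y′
  ... | inj₂ _ = inr∈union V Y Y′
  Answer-⊕ V X Y X′ Y′ (same c d) with splitAt n c | splitAt n d
  ... | inj₁ _ | inj₁ _ = mk⇔ (inl-injective V) (cong (inl V))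
  ... | inj₂ _ | inj₂ _ = mk⇔ (inr-injective V) (cong (inr V))
  ... | inj₁ _ | inj₂ _ = mk⇔ (inl≢inr V) λ ()
  ... | inj₂ _ | inj₁ _ = mk⇔ (inl≢inr V ∘ sym) λ ()

Answer-redefine : ∀ k {n m} (σ : Fin n → Fin m) (G : TypedGraph m) X Y (q : Query k n) →
                  Answer k (redefine σ G) X Y q ⇔ Answer k G X Y (redefQ σ q)
Answer-redefine k σ G X Y met        = ⇔-id _
Answer-redefine V σ G X Y (in₁ _)    = ⇔-id _
Answer-redefine V σ G X Y (in₂ _)    = ⇔-id _
Answer-redefine V σ G X Y (same _ _) = ⇔-id _

Answer-fuse : ∀ k {n} (a b : Fin n) (G : TypedGraph n) X Y (q : Query k n) →
              Answer k (fuse a b G) (image (on (fuseEpi a b G) k) X) (image (on (fuseEpi a b G) k) Y) q ⇔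
              (Answer k G X Y ⊩ fuseQ a b q)
Answer-fuse V a b G X Y met        = Meet-identification (identify-isIdentification _ _) X Y
Answer-fuse E a b G X Y met        = Meet-image id X Y
Answer-fuse V a b G X Y (in₁ c)    = ∈-identification (identify-isIdentification _ _) X
Answer-fuse V a b G X Y (in₂ c)    = ∈-identification (identify-isIdentification _ _) Y
Answer-fuse V a b G X Y (same c d) = identification-kernel (identify-isIdentification _ _)

Answer-≅ : ∀ k {n} {G H : TypedGraph n} (i : G ≅ H) X Y (q : Query k n) →
           Answer k H (image (on (≅⇒Epi i) k) X) (image (on (≅⇒Epi i) k) Y) q ⇔ Answer k G X Y q
Answer-≅ k i X Y met = Meet-image (≅⇒Epi-injective i k) X Y
Answer-≅ V i X Y (in₁ c) rewrite sym (_≅_.terminals i c) = ∈-image-injective (≅⇒Epi-injective i V) X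
Answer-≅ V i X Y (in₂ c) rewrite sym (_≅_.terminals i c) = ∈-image-injective (≅⇒Epi-injective i V) Y
Answer-≅ V i X Y (same c d) rewrite sym (_≅_.terminals i c) | sym (_≅_.terminals i d) =
  mk⇔ (≅⇒Epi-injective i V) (cong (on (≅⇒Epi i) V))

module _ {Γ k} (t u : Term Γ k) where

  private
    State : ℕ → Set
    State n = Powerset (queries k n)

    Answers : ∀ {n} (G : TypedGraph n) → Env Γ (graph G) → Query k n → Set
    Answers G η = Answer k G (eval-term t (graph G) η) (eval-term u (graph G) η)

    answers? : ∀ {n} (G : TypedGraph n) η → Decidable (Answers G η)
    answers? G η = answer? k G (eval-term t (graph G) η) (eval-term u (graph G) η)

    answers : ∀ {n} (G : TypedGraph n) → Env Γ (graph G) → State n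
    answers G η = comprehension (queries k _) (answers? G η)

    ∈-answers : ∀ {n} (G : TypedGraph n) η q → member (queries k n) q (answers G η) ⇔ Answers G η q
    ∈-answers G η q = member-comprehension (queries k _) (answers? G η)

    module _ {n m} (S : State n) (T : State m) where
      Either : Query k n ⊎ Query k m → Set
      Either = [ (λ q → member (queries k n) q S) , (λ q → member (queries k m) q T) ]′

      either? : Decidable Either
      either? (inj₁ q) = member? (queries k n) q S
      either? (inj₂ q) = member? (queries k m) q T

    sum? : ∀ {n m} (S : State n) (T : State m) → Decidable (λ q → Either S T ⊩ sumQ n q)
    sum? S T q = ⊩? (either? S T) (sumQ _ q)

    redef? : ∀ {n m} (σ : Fin n → Fin m) (S : State m) →
             Decidable (λ q → member (queries k m) (redefQ σ q) S)
    redef? σ S q = member? (queries k _) (redefQ σ q) S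

    fuse? : ∀ {n} (a b : Fin n) (S : State n) →
            Decidable (λ q → (λ r → member (queries k n) r S) ⊩ fuseQ a b q)
    fuse? a b S q = ⊩? (λ r → member? (queries k _) r S) (fuseQ a b q)

  -- The state is the set of queries answered positively for the values of `t` and `u`. Since terms
  -- commute with unions and images, the rules for arbitrary pairs of sets apply to these values.
  meeting : Observation Γ
  meeting = record
    { State   = State
    ; states  = λ n → Finite-Subset _
    ; state   = answers
    ; sumˢ    = λ S T → comprehension (queries k _) (sum? S T)
    ; redefˢ  = λ σ S → comprehension (queries k _) (redef? σ S)
    ; fuseˢ   = λ a b S → comprehension (queries k _) (fuse? a b S)
    ; state-⊕ = λ G H η θ → comprehension-cong (queries k _)
        (answers? (G ⊕ H) (η ⊔ᴱ θ)) (sum? (answers G η) (answers H θ))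
        -- Read from the right: the rule for unions is transported to the values of the terms on the
        -- sum, then answers on the summands are replaced by membership in the stored states.
        (λ q → ⊩-cong (λ { (inj₁ r) → ⇔-sym (∈-answers G η r) ; (inj₂ r) → ⇔-sym (∈-answers H θ r) })
               (sumQ _ q) ⇔-∘
          subst₂ (λ X Y → Answer k (G ⊕ H) X Y q ⇔ ([ Answers G η , Answers H θ ]′ ⊩ sumQ _ q))
            (sym (eval-term-⊔ t η θ)) (sym (eval-term-⊔ u η θ)) (Answer-⊕ G H k _ _ _ _ q))
    ; state-redefine = λ σ G η → comprehension-cong (queries k _)
        (answers? (redefine σ G) η) (redef? σ (answers G η))
        (λ q → ⇔-sym (∈-answers G η (redefQ σ q)) ⇔-∘ Answer-redefine k σ G _ _ q)
    ; state-fuse = λ a b G η → comprehension-cong (queries k _)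
        (answers? (fuse a b G) _) (fuse? a b (answers G η))
        (λ q → ⊩-cong (λ r → ⇔-sym (∈-answers G η r)) (fuseQ a b q) ⇔-∘
          subst₂ (λ X Y → Answer k (fuse a b G) X Y q ⇔ (Answers G η ⊩ fuseQ a b q))
            (sym (eval-term-push t (fuseEpi a b G) η)) (sym (eval-term-push u (fuseEpi a b G) η))
            (Answer-fuse k a b G _ _ q))
    ; state-≅ = λ {n} {G} {H} i η → comprehension-cong (queries k _) (answers? H _) (answers? G η)
        (λ q → subst₂ (λ X Y → Answer k H X Y q ⇔ Answers G η q)
            (sym (eval-term-push t (≅⇒Epi i) η)) (sym (eval-term-push u (≅⇒Epi i) η)) (Answer-≅ k i _ _ q))
    }

  recognise-meets : Recogniser (t meets u)
  recognise-meets = record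
    { observation = meeting
    ; Accept      = member (queries k _) met
    ; correct     = λ G η → ⇔-sym (∈-answers G η met)
    }

-- Recognisers for all core formulas

recogniser : ∀ {Γ} (φ : Core Γ) → Recogniser φ
recogniser (t meets u) = recognise-meets t u
recogniser ⊥ᶜ = record { observation = trivial ; Accept = λ _ → ⊥ ; correct = λ _ _ → ⇔-id _ }
recogniser (φ ∧ᶜ ψ) = record
  { observation = A.observation ⊗ B.observation
  ; Accept      = λ (a , b) → A.Accept a × B.Accept b
  ; correct     = λ G η → A.correct G η ×-⇔ B.correct G η
  }
  where
  module A = Recogniser (recogniser φ)
  module B = Recogniser (recogniser ψ)
recogniser (φ ⇒ᶜ ψ) = record
  { observation = A.observation ⊗ B.observation
  ; Accept      = λ (a , b) → A.Accept a → B.Accept b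
  ; correct     = λ G η → mk⇔ (λ f → ⇒ (B.correct G η) ∘ f ∘ ⇐ (A.correct G η))
                              (λ f → ⇐ (B.correct G η) ∘ f ∘ ⇒ (A.correct G η))
  }
  where
  module A = Recogniser (recogniser φ)
  module B = Recogniser (recogniser ψ)
recogniser (∀ᶜ k φ) = record
  { observation = power A.observation
  -- `S` consists of exactly the states that some label produces, so quantifying over labels amounts
  -- to quantifying over its members.
  ; Accept      = λ S → ∀ a → member (A.states _) a S → A.Accept a
  ; correct     = λ G η → mk⇔
      (λ f a a∈ → let X , e = ⇒ (member-power A.observation G η) a∈
                  in subst A.Accept e (⇒ (A.correct G (X ∷ η)) (f X)))
      (λ f X → ⇐ (A.correct G (X ∷ η)) (f _ (⇐ (member-power A.observation G η) (X , refl))))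
  }
  where
  module A = Recogniser (recogniser φ)

-- Translation of formulas

Var : List Kind → Set
Var Γ = ∃ (_∈ˡ Γ)

shift : ∀ {k Γ} → Var Γ → Var (k ∷ Γ)
shift (l , x) = l , there x

extend : ∀ {k Γ i} → (Fin i → Var Γ) → Fin (suc i) → Var (k ∷ Γ)
extend f zero    = _ , here refl
extend f (suc x) = shift (f x)

⊤ᶜ : ∀ {Γ} → Core Γ
⊤ᶜ = ⊥ᶜ ⇒ᶜ ⊥ᶜ

⋀ : ∀ {Γ m} → (Fin m → Core Γ) → Core Γ
⋀ {m = zero}  φ = ⊤ᶜ
⋀ {m = suc m} φ = φ zero ∧ᶜ ⋀ (φ ∘ suc)

-- A set is a singleton iff it is nonempty and any two sets meeting it meet
-- each other.

singleton : ∀ {k Γ} → k ∈ˡ Γ → Core Γ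
singleton {k} x = (var x meets var x) ∧ᶜ
  ∀ᶜ k (var (there x) meets var (here refl) ⇒ᶜ
    ∀ᶜ k (var (there (there x)) meets var (here refl) ⇒ᶜ var (there (here refl)) meets var (here refl)))

kindIs : ∀ {Γ} → Kind → Var Γ → Core Γ
kindIs V (V , _) = ⊤ᶜ
kindIs E (E , _) = ⊤ᶜ
kindIs _ _       = ⊥ᶜ

-- Serves for equality as well as membership, since individuals are named by singletons. Different
-- kinds give `⊥ᶜ`, as no vertex equals an edge or lies in a set of edges, and conversely.
meetsᵛ : ∀ {Γ} → Var Γ → Var Γ → Core Γ
meetsᵛ (V , x) (V , y) = var x meets var y
meetsᵛ (E , x) (E , y) = var x meets var y
meetsᵛ _       _       = ⊥ᶜ

endIs : ∀ {Γ} → ℕ → E ∈ˡ Γ → Var Γ → Core Γ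
endIs j y (V , x) = end j (var y) meets var x
endIs j y (E , _) = ⊥ᶜ

-- The length test ensures that each `toℕ j` is a genuine position in the word, so that `endIs`
-- never tests the default end point.
connᶜ : ∀ {Γ m} → Var Γ → (Fin m → Var Γ) → Core Γ
connᶜ         (V , _) xs = ⊥ᶜ
connᶜ {m = m} (E , y) xs = (var y meets len m) ∧ᶜ ⋀ (λ j → endIs (toℕ j) y (xs j))

-- `f` and `g` fix the kind of every free variable, so each quantifier becomes a conjunction over
-- the two kinds, with its body translated once for each.
translate : ∀ {i s Γ} → Formula i s → (Fin i → Var Γ) → (Fin s → Var Γ) → Core Γ
translate (vert x)      f g = kindIs V (f x)
translate (edge x)      f g = kindIs E (f x)
translate (x ≐′ y)      f g = meetsᵛ (f x) (f y)
translate (x ∈′ X)      f g = meetsᵛ (f x) (g X)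
translate (conn m y xs) f g = connᶜ (f y) (f ∘ lookup xs)
translate (¬′ φ)        f g = translate φ f g ⇒ᶜ ⊥ᶜ
translate (φ ∧′ ψ)      f g = translate φ f g ∧ᶜ translate ψ f g
translate (∀₁ φ)        f g = ∀ᶜ V (singleton (here refl) ⇒ᶜ translate φ (extend f) (shift ∘ g)) ∧ᶜ
                              ∀ᶜ E (singleton (here refl) ⇒ᶜ translate φ (extend f) (shift ∘ g))
translate (∀₂ φ)        f g = ∀ᶜ V (translate φ (shift ∘ f) (extend g)) ∧ᶜ
                              ∀ᶜ E (translate φ (shift ∘ f) (extend g))

-- Correctness of the translation

Meet-⁅⁆ : ∀ {n} {x : Fin n} {X Y} → X ≡ ⁅ x ⁆ → Meet X Y ⇔ x ∈ Y
Meet-⁅⁆ {x = x} {Y = Y} refl = mk⇔ (λ (y , y∈ , y∈Y) → subst (_∈ Y) (x∈⁅y⁆⇒x≡y x y∈) y∈Y)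
    (λ x∈ → x , x∈⁅x⁆ x , x∈)

∈-⁅⁆ : ∀ {n} {x y : Fin n} {Y} → Y ≡ ⁅ y ⁆ → x ∈ Y ⇔ x ≡ y
∈-⁅⁆ refl = x∈⁅y⁆⇔x≡y

word-⇔ : ∀ {A B : Set} {m} (f : A → B) d (w : List A) (xs : Vec B m) →
         List.map f w ≡ Vec.toList xs ⇔ (length w ≡ m × (∀ j → f (nth (toℕ j) d w) ≡ lookup xs j))
word-⇔ f d []      []       = mk⇔ (λ _ → refl , λ ()) (λ _ → refl)
word-⇔ f d []      (x ∷ xs) = mk⇔ (λ ()) (λ ())
word-⇔ f d (a ∷ w) []       = mk⇔ (λ ()) (λ ())
word-⇔ {m = suc m} f d (a ∷ w) (x ∷ xs) = mk⇔ fwd bwd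
  where
  fwd : f a ∷ List.map f w ≡ x ∷ Vec.toList xs →
        suc (length w) ≡ suc m × (∀ j → f (nth (toℕ j) d (a ∷ w)) ≡ lookup (x ∷ xs) j)
  fwd e with ⇒ (word-⇔ f d w xs) (∷-injectiveʳ e)
  ... | l , n = cong suc l , λ { zero → ∷-injectiveˡ e ; (suc j) → n j }
  bwd : suc (length w) ≡ suc m × (∀ j → f (nth (toℕ j) d (a ∷ w)) ≡ lookup (x ∷ xs) j) →
        f a ∷ List.map f w ≡ x ∷ Vec.toList xs
  bwd (l , n) = cong₂ _∷_ (n zero) (⇐ (word-⇔ f d w xs) (ℕ.suc-injective l , n ∘ suc))

module _ (G : Graph) where
  open Structure (Ω G) using (Individual; SetValue; Conn) renaming (_∈_ to _∈Ω_)

  individual : ∀ k → Elt k G → Individual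
  individual V = inj₁
  individual E = inj₂

  setValue : ∀ k → Subset (count k G) → SetValue
  setValue V = inj₁
  setValue E = inj₂

  module _ {Γ} (η : Env Γ G) where

    Denotes₁ : Var Γ → Individual → Set
    Denotes₁ (k , v) a = ∃[ x ] a ≡ individual k x × All.lookup η v ≡ ⁅ x ⁆

    Denotes₂ : Var Γ → SetValue → Set
    Denotes₂ (k , v) A = A ≡ setValue k (All.lookup η v)

    ⋀-correct : ∀ {m} (φ : Fin m → Core Γ) → (∀ j → G , η ⊨ φ j) ⇔ (G , η ⊨ ⋀ φ)
    ⋀-correct {zero}  φ = mk⇔ (λ _ → id) (λ _ ())
    ⋀-correct {suc m} φ = mk⇔
      (λ h → h zero , ⇒ (⋀-correct (φ ∘ suc)) (h ∘ suc))
      (λ { (h , t) zero → h ; (h , t) (suc j) → ⇐ (⋀-correct (φ ∘ suc)) t j })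

    singleton-correct : ∀ {k} (v : k ∈ˡ Γ) → (∃[ x ] All.lookup η v ≡ ⁅ x ⁆) ⇔ (G , η ⊨ singleton v)
    singleton-correct v = mk⇔
      (λ (x , e) → ⇐ (Meet-⁅⁆ e) (⇐ (∈-⁅⁆ e) refl) , λ X p Y q → x , ⇒ (Meet-⁅⁆ e) p , ⇒ (Meet-⁅⁆ e) q)
      (λ ((x , x∈ , _) , p) → x , ⊆⊇⇒≡ (λ y → mk⇔
        -- The test sets are `⁅ x ⁆` and `⁅ y ⁆`: both meet the given set, hence each other, and so
        -- `x` and `y` coincide.
        (λ y∈ → ⇐ x∈⁅y⁆⇔x≡y (sym (⇒ x∈⁅y⁆⇔x≡y (⇒ (Meet-⁅⁆ refl)
          (p ⁅ x ⁆ (x , x∈ , x∈⁅x⁆ x) ⁅ y ⁆ (y , y∈ , x∈⁅x⁆ y))))))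
        (λ y∈ → subst (_∈ All.lookup η v) (sym (⇒ x∈⁅y⁆⇔x≡y y∈)) x∈)))

    kindIs-correct : ∀ k w {a} → Denotes₁ w a → (∃[ x ] a ≡ individual k x) ⇔ (G , η ⊨ kindIs k w)
    kindIs-correct V (V , _) (x , refl , _) = mk⇔ (λ _ → id) (λ _ → x , refl)
    kindIs-correct V (E , _) (x , refl , _) = mk⇔ (λ ()) (λ ())
    kindIs-correct E (V , _) (x , refl , _) = mk⇔ (λ ()) (λ ())
    kindIs-correct E (E , _) (x , refl , _) = mk⇔ (λ _ → id) (λ _ → x , refl)

    equal-correct : ∀ w w′ {a b} → Denotes₁ w a → Denotes₁ w′ b → (a ≡ b) ⇔ (G , η ⊨ meetsᵛ w w′)
    equal-correct (V , _) (V , _) (x , refl , p) (y , refl , q) =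
      ⇔-sym (Meet-⁅⁆ p) ⇔-∘ (⇔-sym (∈-⁅⁆ q) ⇔-∘ mk⇔ inj₁-injective (cong inj₁))
    equal-correct (E , _) (E , _) (x , refl , p) (y , refl , q) =
      ⇔-sym (Meet-⁅⁆ p) ⇔-∘ (⇔-sym (∈-⁅⁆ q) ⇔-∘ mk⇔ inj₂-injective (cong inj₂))
    equal-correct (V , _) (E , _) (x , refl , p) (y , refl , q) = mk⇔ (λ ()) (λ ())
    equal-correct (E , _) (V , _) (x , refl , p) (y , refl , q) = mk⇔ (λ ()) (λ ())

    ∈-correct : ∀ w w′ {a A} → Denotes₁ w a → Denotes₂ w′ A → (a ∈Ω A) ⇔ (G , η ⊨ meetsᵛ w w′)
    ∈-correct (V , _) (V , _) (x , refl , p) refl = ⇔-sym (Meet-⁅⁆ p)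
    ∈-correct (E , _) (E , _) (x , refl , p) refl = ⇔-sym (Meet-⁅⁆ p)
    ∈-correct (V , _) (E , _) (x , refl , p) refl = mk⇔ (λ ()) (λ ())
    ∈-correct (E , _) (V , _) (x , refl , p) refl = mk⇔ (λ ()) (λ ())

    -- The set of `j`-th end points of a singleton of edges is itself a singleton, so meeting the
    -- singleton of a vertex means equality.
    endIs-correct : ∀ j v {e} → All.lookup η v ≡ ⁅ e ⁆ → ∀ w {b} → Denotes₁ w b →
                    (inj₁ (endpoint {G} j e) ≡ b) ⇔ (G , η ⊨ endIs j v w)
    endIs-correct j v {e} p (E , _) (_ , refl , _) = mk⇔ (λ ()) (λ ())
    endIs-correct j v {e} p (V , z) (x , refl , q) = mk⇔ fwd bwd
      where
      fwd : inj₁ (endpoint {G} j e) ≡ inj₁ x → G , η ⊨ endIs j v (V , z)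
      fwd refl = x , ⇐ (∈-image _ _) (e , ⇐ (∈-⁅⁆ p) refl , refl) , ⇐ (∈-⁅⁆ q) refl
      bwd : G , η ⊨ endIs j v (V , z) → inj₁ (endpoint {G} j e) ≡ inj₁ x
      bwd (u , u∈ , u∈x) with ⇒ (∈-image (endpoint {G} j) (All.lookup η v)) u∈
      ... | e′ , e′∈ , refl with ⇒ (∈-⁅⁆ p) e′∈
      ... | refl = cong inj₁ (⇒ (∈-⁅⁆ q) u∈x)

    conn-correct : ∀ {m} w {a} (zs : Fin m → Var Γ) {bs : Vec Individual m} →
                   Denotes₁ w a → (∀ j → Denotes₁ (zs j) (lookup bs j)) →
                   Conn m a bs ⇔ (G , η ⊨ connᶜ w zs)
    conn-correct (V , _) zs (_ , refl , _) ds = mk⇔ (λ ()) (λ ())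
    conn-correct {m} (E , v) zs {bs} (e , refl , p) ds =
      -- `word-⇔` splits the equation of words into length and letters. The length is tested by
      -- letting the singleton of `e` meet `len m`, each letter by `endIs`.
      ((⇔-sym (Meet-⁅⁆ p) ⇔-∘ ⇔-sym (∈-⟪⟫ _)) ×-⇔
       (⋀-correct _ ⇔-∘ mk⇔ (λ h j → ⇒ (endIs-correct (toℕ j) v p (zs j) (ds j)) (h j))
                            (λ h j → ⇐ (endIs-correct (toℕ j) v p (zs j) (ds j)) (h j))))
      ⇔-∘ (word-⇔ inj₁ _ (toList (Graph.ends G e)) bs
      ⇔-∘ mk⇔ (λ { (_ , refl , q) → q }) (λ q → e , refl , q))

  extend₁ : ∀ {k Γ i} {η : Env Γ G} {f : Fin i → Var Γ} {ρ : Vec Individual i} {X} x → X ≡ ⁅ x ⁆ →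
            (∀ y → Denotes₁ η (f y) (lookup ρ y)) →
            ∀ y → Denotes₁ {k ∷ Γ} (X ∷ η) (extend f y) (lookup (individual k x ∷ ρ) y)
  extend₁ x e d zero    = x , refl , e
  extend₁ x e d (suc y) = d y

  extend₂ : ∀ {k Γ i} {η : Env Γ G} {g : Fin i → Var Γ} {θ : Vec SetValue i} {X} →
            (∀ Y → Denotes₂ η (g Y) (lookup θ Y)) →
            ∀ Y → Denotes₂ {k ∷ Γ} (X ∷ η) (extend g Y) (lookup (setValue k X ∷ θ) Y)
  extend₂ d zero    = refl
  extend₂ d (suc Y) = d Y

  translate-correct : ∀ {i s Γ} (φ : Formula i s) {f : Fin i → Var Γ} {g : Fin s → Var Γ}
                      {ρ θ} {η : Env Γ G} →
                      (∀ x → Denotes₁ η (f x) (lookup ρ x)) → (∀ X → Denotes₂ η (g X) (lookup θ X)) →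
                      Holds (Ω G) φ ρ θ ⇔ (G , η ⊨ translate φ f g)
  translate-correct (vert x) {η = η} d₁ d₂ = kindIs-correct η V _ (d₁ x)
  translate-correct (edge x) {η = η} d₁ d₂ = kindIs-correct η E _ (d₁ x)
  translate-correct (x ≐′ y) {η = η} d₁ d₂ = equal-correct η _ _ (d₁ x) (d₁ y)
  translate-correct (x ∈′ X) {η = η} d₁ d₂ = ∈-correct η _ _ (d₁ x) (d₂ X)
  translate-correct (conn m y xs) {f} {ρ = ρ} {η = η} d₁ d₂ = conn-correct η _ (f ∘ lookup xs) (d₁ y)
    (λ j → subst (Denotes₁ η (f (lookup xs j))) (sym (lookup-map j (lookup ρ) xs)) (d₁ (lookup xs j)))
  translate-correct (¬′ φ) d₁ d₂ = mk⇔ (_∘ ⇐ (translate-correct φ d₁ d₂)) (_∘ ⇒ (translate-correct φ d₁ d₂))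
  translate-correct (φ ∧′ ψ) d₁ d₂ = translate-correct φ d₁ d₂ ×-⇔ translate-correct ψ d₁ d₂
  translate-correct (∀₁ φ) {f} {g} {ρ} {θ} {η} d₁ d₂ = mk⇔
    (λ h → part V (λ x → h (inj₁ x)) , part E (λ x → h (inj₂ x)))
    (λ { (hV , hE) (inj₁ x) → trap V hV x ; (hV , hE) (inj₂ x) → trap E hE x })
    where
    body : ∀ k → Core _
    body k = translate φ (extend {k} f) (shift ∘ g)
    -- A set satisfying `singleton` is `⁅ x ⁆` for some `x`, and the universal statement is used at
    -- that individual.
    part : ∀ k → (∀ x → Holds (Ω G) φ (individual k x ∷ ρ) θ) →
           ∀ X → G , X ∷ η ⊨ (singleton {k} (here refl) ⇒ᶜ body k)
    part k h X sing with ⇐ (singleton-correct (X ∷ η) {k} (here refl)) sing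
    ... | x , e = ⇒ (translate-correct φ (extend₁ {k} x e d₁) d₂) (h x)
    -- Conversely, the individual `x` is reached by choosing the set `⁅ x ⁆`.
    trap : ∀ k → (∀ X → G , X ∷ η ⊨ (singleton {k} (here refl) ⇒ᶜ body k)) →
           ∀ x → Holds (Ω G) φ (individual k x ∷ ρ) θ
    trap k h x = ⇐ (translate-correct φ (extend₁ {k} x refl d₁) d₂)
                   (h ⁅ x ⁆ (⇒ (singleton-correct (⁅ x ⁆ ∷ η) {k} (here refl)) (x , refl)))
  translate-correct (∀₂ φ) d₁ d₂ = mk⇔
    (λ h → (λ X → ⇒ (translate-correct φ d₁ (extend₂ {V} d₂)) (h (inj₁ X))) ,
           (λ X → ⇒ (translate-correct φ d₁ (extend₂ {E} d₂)) (h (inj₂ X))))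
    (λ { (hV , hE) (inj₁ X) → ⇐ (translate-correct φ d₁ (extend₂ {V} d₂)) (hV X)
       ; (hV , hE) (inj₂ X) → ⇐ (translate-correct φ d₁ (extend₂ {E} d₂)) (hE X) })

-- Recognisability in the algebra of all graphs

𝔊-recognisable : (φ : Sentence) (n : ℕ) → Recognisable 𝔊 n (λ G → ⊨[ Ω (graph G) ] φ)
𝔊-recognisable φ n = record
  { B             = B
  ; locallyFinite = λ t → card (states t) , enum (states t)
  ; h             = record
    { map      = λ t → value
    ; map-cong = λ t → value-cong
    ; map-op   = map-op
    }
  ; M             = Accept
  ; M-resp        = λ { refl a → a }
  ; preimage      = (λ {G} → ⇒ (accepted G)) , (λ {G} → ⇐ (accepted G))
  }
  where
  -- A sentence translates into the empty context, so the graphs to be observed carry no labels.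
  open Recogniser (recogniser (translate {Γ = []} φ (λ ()) (λ ())))
  open Signature graphSignature
  value : ∀ {t} → TypedGraph t → State t
  value G = state G []
  value-cong : ∀ {t} {G H : TypedGraph t} → G ≅ H → value G ≡ value H
  value-cong i = sym (state-≅ i [])
  op : ∀ g → Tuple (setoid ∘ State) (dom g) → State (cod g)
  op (sum _ _)    (a ∷ b ∷ []) = sumˢ a b
  op (redef σ)    (a ∷ [])     = redefˢ σ a
  op (fusion a b) (x ∷ [])     = fuseˢ a b x
  -- Constants are interpreted by the states of their own graphs, so the morphism law holds for them
  -- by definition.
  op vertex       []           = value 𝔳
  op (edge k)     []           = value (𝔢 k)
  ≈*⇒≡ : ∀ {ts} {xs ys : Tuple (setoid ∘ State) ts} → _≈*_ (setoid ∘ State) xs ys → xs ≡ ys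
  ≈*⇒≡ []         = refl
  ≈*⇒≡ (refl ∷ p) = cong (_ ∷_) (≈*⇒≡ p)
  B : Algebra graphSignature 0ℓ 0ℓ
  B = record { carrier = setoid ∘ State ; op = op ; op-cong = λ g → cong (op g) ∘ ≈*⇒≡ }
  map-op : ∀ g xs → value (Algebra.op 𝔊 g xs) ≡ op g (All.map value xs)
  map-op (sum _ _)    (G ∷ H ∷ []) = state-⊕ G H [] []
  map-op (redef σ)    (G ∷ [])     = state-redefine σ G []
  map-op (fusion a b) (G ∷ [])     = state-fuse a b G []
  map-op vertex       []           = refl
  map-op (edge k)     []           = refl
  accepted : ∀ (G : TypedGraph n) → ⊨[ Ω (graph G) ] φ ⇔ Accept (value G)
  accepted G = correct G [] ⇔-∘ translate-correct (graph G) φ (λ ()) (λ ())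

-- Inherited algebras

module _ {a p q} {A : Set a} {P : Pred A p} {Q : Pred A q} (f : ∀ {x} → P x → Q x) where

  map-++⁻ˡ : ∀ xs {ys} (ps : All P (xs List.++ ys)) → All.map f (++⁻ˡ xs ps) ≡ ++⁻ˡ xs (All.map f ps)
  map-++⁻ˡ []       ps       = refl
  map-++⁻ˡ (x ∷ xs) (p ∷ ps) = cong (f p ∷_) (map-++⁻ˡ xs ps)

  map-++⁻ʳ : ∀ xs {ys} (ps : All P (xs List.++ ys)) → All.map f (++⁻ʳ xs ps) ≡ ++⁻ʳ xs (All.map f ps)
  map-++⁻ʳ []       ps       = refl
  map-++⁻ʳ (x ∷ xs) (p ∷ ps) = map-++⁻ʳ xs ps

module _ {s f c ℓ c′ ℓ′} {S : Signature s f} {A : Algebra S c ℓ} {B : Algebra S c′ ℓ′}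
         (h : Morphism A B) where
  open Signature S
  open Morphism h
  private
    module A = Algebra A
    module B = Algebra B

  map* : ∀ {ts} → Tuple A.carrier ts → Tuple B.carrier ts
  map* = All.map (λ {t} → map t)

  -- Compatibility with single function symbols extends to derived operations by induction on the
  -- tree.
  map-eval  : ∀ {t} (e : PreExpr S t) xs → map t (eval A e xs) B.≈ eval B e (map* xs)
  map-eval* : ∀ {ts} (es : All (PreExpr S) ts) xs →
              _≈*_ B.carrier (map* (eval* A es xs)) (eval* B es (map* xs))
  map-eval (leaf g)    xs = map-op g xs
  map-eval (node g es) xs = Setoid.trans (B.carrier _) (map-op g (eval* A es xs))
      (B.op-cong g (map-eval* es xs))
  map-eval* []       xs = []
  map-eval* (e ∷ es) xs =
    -- The inputs may be mapped before or after they are split among the children; both orders give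
    -- the same tuple, but only propositionally.
    subst (λ ys → _ B.≈ eval B e ys) (map-++⁻ˡ (map _) (inputs e) xs) (map-eval e (++⁻ˡ (inputs e) xs)) ∷
    subst (λ ys → _≈*_ B.carrier (map* (eval* A es (++⁻ʳ (inputs e) xs))) (eval* B es ys))
          (map-++⁻ʳ (map _) (inputs e) xs) (map-eval* es (++⁻ʳ (inputs e) xs))

  flattening-morphism : Morphism (flattening A) (flattening B)
  flattening-morphism = record
    { map      = map
    ; map-cong = map-cong
    ; map-op   = λ { (inj₁ g) → map-op g ; (inj₂ (_ , e)) → map-eval e }
    }

  -- This differs from the closure of `B`: its signature has a constant for each element of `A`,
  -- interpreted by the image of that element.
  closureAlong : Algebra (closureSignature A) c′ ℓ′
  closureAlong = record
    { carrier = B.carrier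
    ; op      = λ { (inj₁ g) → B.op g ; (inj₂ (t , x)) _ → map t x }
    ; op-cong = λ { (inj₁ g) → B.op-cong g ; (inj₂ (t , x)) _ → Setoid.refl (B.carrier t) }
    }

  closure-morphism : Morphism (closure A) closureAlong
  closure-morphism = record
    { map      = map
    ; map-cong = map-cong
    ; map-op   = λ { (inj₁ g) → map-op g ; (inj₂ (t , x)) _ → Setoid.refl (B.carrier t) }
    }

module _ {s f c ℓ c′ ℓ′ p q} {S : Signature s f} {A : Algebra S c ℓ} {B : Algebra S c′ ℓ′}
         (h : Morphism A B) (I : Subalgebra A p q) where
  open Signature S using (cod)
  open Morphism h
  private
    module B = Algebra B
    module I = Subalgebra I

  -- Only the function symbols are restricted; the carriers are all of those of `B`, so local
  -- finiteness carries over.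
  reduct : Algebra I.signature c′ ℓ′
  reduct = record
    { carrier = B.carrier
    ; op      = λ (g , _) → B.op g
    ; op-cong = λ (g , _) → B.op-cong g
    }

  restriction : Morphism I.algebra reduct
  restriction = record
    { map      = λ t → map t ∘ proj₁
    ; map-cong = λ t → map-cong t
    ; map-op   = λ (g , _) xs → subst (λ ys → map (cod g) (Algebra.op A g (All.map proj₁ xs)) B.≈ B.op g ys)
                                      (map-∘ xs) (map-op g (All.map proj₁ xs))
    }

-- Closure, flattening and reduct change only the operations of the finite algebra, so the same
-- accepting set `M` serves, with the morphism restricted to the subcarriers.
inherited-recognisable : ∀ {s f c ℓ p q r} {S : Signature s f} {A : Algebra S c ℓ}
                         (I : InheritedAlgebra A p q)
                         {t} {L : Pred (Algebra.Carrier A t) r} →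
                         Recognisable A t L → Recognisable (Subalgebra.algebra I) t (L ∘ proj₁)
inherited-recognisable I R = record
  { B             = reduct (flattening-morphism (closure-morphism h)) I
  ; locallyFinite = locallyFinite
  ; h             = restriction (flattening-morphism (closure-morphism h)) I
  ; M             = M
  ; M-resp        = M-resp
  ; preimage      = proj₁ preimage , proj₂ preimage
  }
  where open Recognisable R

theorem7p1p2 : ∀ {p q : Level} (A : InheritedAlgebra 𝔊 p q) (φ : Sentence) (n : ℕ) →
    Recognisable (Subalgebra.algebra A) n (λ G → ⊨[ Ω (TypedGraph.graph (proj₁ G)) ] φ)
theorem7p1p2 A φ n = inherited-recognisable A (𝔊-recognisable φ n)
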